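{- Let $n\geq 4$ and let ${}_{n}w=[n,1,2,\dots,n-4,n-2,n-1,n-3]\in\mathfrak{S}_n$ (i.e. ${}_{n}w(1)=n$, ${}_{n}w(i)=i-1$ for $2\leq i\leq n-3$, ${}_{n}w(n-2)=n-2$, ${}_{n}w(n-1)=n-1$, ${}_{n}w(n)=n-3$), and let $\mathcal{G}_{{}_{n}w}$ be the graph of reduced words of ${}_{n}w$. Then its vertex-degree polynomial is $$\mathrm{P}_{\mathcal{G}_{{}_{n}w}}(d)=2d+(n-2)d^2+(2n-6)d^3+\binom{n-3}{2}d^4,$$ the sum of the degrees of its vertices is $\sum_{v}\deg v=4\binom{n-1}{2}$, and $\mathcal{G}_{{}_{n}w}$ contains precisely $\binom{n-2}{2}$ cycles of length $4$.
   Context: $s_i$ is the simple transposition exchanging $i,i+1$; permutations compose as functions. A reduced word of $w$ is a sequence $a_1\cdots a_p$ with $w=s_{a_1}\cdots s_{a_p}$ and $p$ the number of inversions of $w$. The graph $\mathcal{G}_w$ has the reduced words of $w$ as vertices, two being adjacent if one is obtained from the other by a single commutation move (swapping adjacent letters $i,j$ with $|i-j|>1$) or a single braid move (replacing a factor $i(i+1)i$ by $(i+1)i(i+1)$ or vice versa). The vertex-degree polynomial of a graph $G$ is $\mathrm{P}_G(d)=\sum_{v\in V(G)}d^{\deg v}$, i.e. the coefficient of $d^k$ is the number of vertices of degree $k$. -}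

module Defs where

open import Data.Nat using (ℕ; zero; suc; _+_; _*_; _∸_; _≟_; _<ᵇ_)
open import Data.Nat.DivMod using (_/_)
open import Data.Bool using (Bool; true; false; if_then_else_; _∧_; _∨_)
open import Data.List using (List; []; _∷_; _++_; map; concatMap; filterᵇ; length)
open import Data.Bool.ListAction using (and)
open import Data.Nat.ListAction using (sum)
open import Data.Nat.Combinatorics using (_C_)
import Data.List.Properties as LP
open import Data.List.Membership.DecPropositional (LP.≡-dec _≟_) using (_∈?_)
open import Relation.Nullary.Decidable using (⌊_⌋)

infix 4 _==_
_==_ : ℕ → ℕ → Bool
m == n = ⌊ m ≟ n ⌋

count : {A : Set} → (A → Bool) → List A → ℕ
count p xs = length (filterᵇ p xs)

range : ℕ → ℕ → List ℕ
range a zero    = []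
range a (suc k) = a ∷ range (suc a) k

-- Permutations of {1,…,n} are represented as functions ℕ → ℕ;
-- only their values on 1..n matter.

s : ℕ → ℕ → ℕ
s i x = if x == i then suc i else (if x == suc i then i else x)

evalWord : List ℕ → ℕ → ℕ
evalWord []       x = x
evalWord (a ∷ as) x = s a (evalWord as x)

inversions : ℕ → (ℕ → ℕ) → ℕ
inversions n w =
  sum (map (λ i → count (λ j → w j <ᵇ w i) (range (suc i) (n ∸ i))) (range 1 n))

words : ℕ → ℕ → List (List ℕ)
words zero    m = [] ∷ []
words (suc p) m = concatMap (λ a → map (a ∷_) (words p m)) (range 1 m)

isReducedWord : ℕ → (ℕ → ℕ) → List ℕ → Bool
isReducedWord n w a =
  and (map (λ k → (1 Data.Nat.≤ᵇ k) ∧ (k Data.Nat.<ᵇ n)) a)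
  ∧ and (map (λ x → evalWord a x == w x) (range 1 n))
  ∧ (length a == inversions n w)

reducedWords : ℕ → (ℕ → ℕ) → List (List ℕ)
reducedWords n w = filterᵇ (isReducedWord n w) (words (inversions n w) (n ∸ 1))

farApart : ℕ → ℕ → Bool
farApart a b = (suc a Data.Nat.<ᵇ b) ∨ (suc b Data.Nat.<ᵇ a)

frontMoves : List ℕ → List (List ℕ)
frontMoves (a ∷ b ∷ xs) =
  (if farApart a b then (b ∷ a ∷ xs) ∷ [] else [])
  ++ braidMoves a b xs
  where
    braidMoves : ℕ → ℕ → List ℕ → List (List ℕ)
    braidMoves a b (c ∷ ys) =
      if (c == a) ∧ ((b == suc a) ∨ (a == suc b)) then (b ∷ a ∷ b ∷ ys) ∷ [] else []
    braidMoves a b [] = []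
frontMoves _ = []

oneMove : List ℕ → List (List ℕ)
oneMove []       = []
oneMove (a ∷ as) = frontMoves (a ∷ as) ++ map (a ∷_) (oneMove as)

adjacent : List ℕ → List ℕ → Bool
adjacent u v = ⌊ v ∈? oneMove u ⌋

degree : ℕ → (ℕ → ℕ) → List ℕ → ℕ
degree n w v = count (adjacent v) (reducedWords n w)

vertexDegreeCoeff : ℕ → (ℕ → ℕ) → ℕ → ℕ
vertexDegreeCoeff n w k = count (λ v → degree n w v == k) (reducedWords n w)

degreeSum : ℕ → (ℕ → ℕ) → ℕ
degreeSum n w = sum (map (degree n w) (reducedWords n w))

-- number of cycles of length 4 in 𝒢_w: the number of closed sequences
-- (v₀,v₁,v₂,v₃) of pairwise distinct vertices with v₀~v₁~v₂~v₃~v₀,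
-- divided by 8 (each 4-cycle is counted once per starting vertex and direction)
fourCycles : ℕ → (ℕ → ℕ) → ℕ
fourCycles n w = length closedWalks / 8
  where
    V = reducedWords n w
    _≠_ : List ℕ → List ℕ → Bool
    u ≠ v = Data.Bool.not ⌊ LP.≡-dec _≟_ u v ⌋
    closedWalks : List (List ℕ)
    closedWalks =
      concatMap (λ a → concatMap (λ b → concatMap (λ c →
        filterᵇ (λ d → adjacent a b ∧ adjacent b c ∧ adjacent c d ∧ adjacent d a
                      ∧ (a ≠ b) ∧ (a ≠ c) ∧ (a ≠ d) ∧ (b ≠ c) ∧ (b ≠ d) ∧ (c ≠ d)) V) V) V) V
      where import Data.Bool

nw : ℕ → ℕ → ℕ
nw n x =
  if x == 1 then n
  else if x == n ∸ 2 then n ∸ 2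
  else if x == n ∸ 1 then n ∸ 1
  else if x == n then n ∸ 3
  else x ∸ 1

rhsCoeff : ℕ → ℕ → ℕ
rhsCoeff n 1 = 2
rhsCoeff n 2 = n ∸ 2
rhsCoeff n 3 = 2 * n ∸ 6
rhsCoeff n 4 = (n ∸ 3) C 2
rhsCoeff n _ = 0

{-# OPTIONS --safe #-}

-- Read a word from right to left and follow the strands of w = nw n.  Strand 1
-- has to climb n - 1 levels past other strands, strand n has to cross the
-- strands n - 1 and n - 2, and no letter serves two of these purposes.  Since w
-- has only n + 1 inversions, a reduced word consists of n - 1 rises of strand 1
-- and two crossings, and it is determined by the heights of strand 1 at the two
-- crossings.  These pairs of heights form a triangle 0 ≤ a ≤ b ≤ n - 2, and the
-- commutation and braid moves are exactly the unit steps of the square grid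
-- inside it.  In this grid graph (a , b) has degree [0 < a] + 2 [a < b] +
-- [b < n - 2], and the 4-cycles are the unit squares.
module Submission where

open import Defs
open import Data.Bool using (Bool; true; false; if_then_else_; T; T?; _∨_; _∧_; not)
open import Data.Bool.ListAction using (and)
open import Data.Bool.Properties using (T-∨; T-∧)
open import Data.Empty using (⊥; ⊥-elim)
open import Data.List using (List; []; _∷_; length; _++_; map; concatMap; filterᵇ; replicate; cartesianProduct; cartesianProductWith)
open import Data.List.Membership.Propositional using (_∈_)
open import Data.List.Membership.Propositional.Properties
open import Data.List.Membership.Propositional.Properties.WithK using (unique∧set⇒bag)
open import Data.List.Properties hiding (sum-++)
open import Data.List.Relation.Binary.BagAndSetEquality using (∼bag⇒↭)
open import Data.List.Relation.Binary.Permutation.Propositional using (_↭_)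
open import Data.List.Relation.Binary.Permutation.Propositional.Properties using (↭-length; filter-↭) renaming (map⁺ to ↭-map)
open import Data.List.Relation.Unary.All as All using (All; []; _∷_)
import Data.List.Relation.Unary.All.Properties as All
open import Data.List.Relation.Unary.AllPairs using ([]; _∷_)
open import Data.List.Relation.Unary.Any using (here; there)
open import Data.List.Relation.Unary.Unique.Propositional using (Unique)
import Data.List.Relation.Unary.Unique.Propositional.Properties as Unique
open import Data.Nat using (ℕ; zero; suc; _+_; _*_; _∸_; _≤_; _<_; z≤n; s≤s; _<ᵇ_; _≤ᵇ_; _≟_; _<?_)
open import Data.Nat.Combinatorics using (_C_; nC1≡n; nCk+nC[k+1]≡[n+1]C[k+1])
open import Data.Nat.DivMod using (_/_; m*n/n≡m)
open import Data.Nat.ListAction using (sum)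
open import Data.Nat.ListAction.Properties using (sum-↭; sum-++)
open import Data.Nat.Properties
open import Data.Nat.Tactic.RingSolver using (solve-∀)
open import Data.Product using (∃; ∃₂; _×_; _,_; proj₁; proj₂)
open import Data.Sum using (_⊎_; inj₁; inj₂)
open import Function using (_∘_)
open import Function.Bundles using (Equivalence; mk⇔)
open import Relation.Binary.PropositionalEquality
open import Relation.Nullary using (Dec; ¬_; yes; no)
open import Relation.Nullary.Decidable using (⌊_⌋; toWitness; fromWitness; toWitnessFalse; fromWitnessFalse)
open import Data.List.Membership.DecPropositional (≡-dec _≟_) using (_∈?_)

-- The potential (height of strand 1, plus one for each crossing made) is 1 for the empty word and
-- `n + 2` at `w`, while a reduced word has `n + 1` letters. So every letter raises it by exactly
-- one, and this alone forces each letter to be a rise or a crossing. The obstacle is that two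
-- strands cannot cross while strand 1 runs between them, so one height is missing for each
-- crossing. Renumbering the remaining heights without gaps produces the regular grid, at the price
-- of four shapes of words. Jumping over a missing height is a braid move, and all other grid steps
-- are commutations. The coordinates are `a`, `d = b - a` and `e = n - 2 - b`, so that the
-- inequalities of the triangle hold by construction and no subtraction occurs. The vertices are
-- obtained by filtering all words of the right length. Their order is never examined:
-- duplicate-free lists with the same members are permutations of each other, and all three
-- invariants are stable under permutation.

private
  variable
    X Y Z : Set

-- Strands

-- The graph of `s i` as a relation: matching on its three cases replaces unfolding nested
-- conditionals, and `SView-functional` turns a constructor back into an equation.
data SView (i : ℕ) : ℕ → ℕ → Set where
  lower : SView i i (suc i)
  upper : SView i (suc i) i
  fixed : ∀ {x} → x ≢ i → x ≢ suc i → SView i x x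

sView : ∀ i x → SView i x (s i x)
sView i x with x ≟ i
... | yes refl = lower
... | no x≢i with x ≟ suc i
...   | yes refl = upper
...   | no x≢1+i = fixed x≢i x≢1+i

SView-functional : ∀ {i x y z} → SView i x y → SView i x z → y ≡ z
SView-functional lower       lower       = refl
SView-functional lower       (fixed p _) = ⊥-elim (p refl)
SView-functional upper       upper       = refl
SView-functional upper       (fixed _ p) = ⊥-elim (p refl)
SView-functional (fixed p _) lower       = ⊥-elim (p refl)
SView-functional (fixed _ p) upper       = ⊥-elim (p refl)
SView-functional (fixed _ _) (fixed _ _) = refl

s-lower : ∀ i → s i i ≡ suc i
s-lower i = SView-functional (sView i i) lower

s-upper : ∀ i → s i (suc i) ≡ i
s-upper i = SView-functional (sView i (suc i)) upper

s-fixed : ∀ {i x} → x ≢ i → x ≢ suc i → s i x ≡ x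
s-fixed p q = SView-functional (sView _ _) (fixed p q)

s-suc : ∀ i x → s (suc i) (suc x) ≡ suc (s i x)
s-suc i x = SView-functional (sView (suc i) (suc x)) (shift (sView i x))
  where
  shift : ∀ {i x y} → SView i x y → SView (suc i) (suc x) (suc y)
  shift lower       = lower
  shift upper       = upper
  shift (fixed p q) = fixed (p ∘ suc-injective) (q ∘ suc-injective)

s-involutive : ∀ i x → s i (s i x) ≡ x
s-involutive i x = SView-functional (sView i (s i x)) (flip (sView i x))
  where
  flip : ∀ {i x y} → SView i x y → SView i y x
  flip lower       = upper
  flip upper       = lower
  flip (fixed p q) = fixed p q

s-injective : ∀ i {x y} → s i x ≡ s i y → x ≡ y
s-injective i {x} {y} e =
  trans (sym (s-involutive i x)) (trans (cong (s i) e) (s-involutive i y))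

evalWord-injective : ∀ u {x y} → evalWord u x ≡ evalWord u y → x ≡ y
evalWord-injective []      e = e
evalWord-injective (a ∷ u) e = evalWord-injective u (s-injective a e)

-- The order-preserving injection of ℕ whose image misses q.
punch : ℕ → ℕ → ℕ
punch zero    i       = suc i
punch (suc q) zero    = zero
punch (suc q) (suc i) = suc (punch q i)

punch-< : ∀ {q i} → i < q → punch q i ≡ i
punch-< {suc q} {zero}  _       = refl
punch-< {suc q} {suc i} (s≤s p) = cong suc (punch-< p)

punch-≥ : ∀ {q i} → q ≤ i → punch q i ≡ suc i
punch-≥ {zero}  {i}     _       = refl
punch-≥ {suc q} {suc i} (s≤s p) = cong suc (punch-≥ p)

-- The gap at `q` is the place of strand 1, so this is the effect of a rise on the other strands:
-- the gap moves up and their relative order is kept.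
s-punch : ∀ q i → s q (punch q i) ≡ punch (suc q) i
s-punch zero    zero    = s-upper 0
s-punch zero    (suc i) = s-fixed {0} {suc (suc i)} (λ ()) (λ ())
s-punch (suc q) zero    = s-fixed {suc q} {0} (λ ()) (λ ())
s-punch (suc q) (suc i) = trans (s-suc q (punch q i)) (cong suc (s-punch q i))

-- Below the gap, heights and ranks agree, and a letter that stays there acts on the ranks
-- unchanged.
s-punch-below : ∀ {q} a i → suc a < q → s a (punch q i) ≡ punch q (s a i)
s-punch-below {suc (suc q)} zero zero          _ = trans (s-lower 0) (sym (cong (punch (suc (suc q))) (s-lower 0)))
s-punch-below {suc (suc q)} zero (suc zero)    _ = trans (s-upper 0) (sym (cong (punch (suc (suc q))) (s-upper 0)))
s-punch-below {suc (suc q)} zero (suc (suc i)) _ =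
  trans (s-fixed {0} {suc (suc (punch q i))} (λ ()) (λ ()))
        (sym (cong (punch (suc (suc q))) (s-fixed {0} {suc (suc i)} (λ ()) (λ ()))))
s-punch-below {suc q} (suc a) zero    (s≤s p) =
  trans (s-fixed {suc a} {0} (λ ()) (λ ()))
        (sym (cong (punch (suc q)) (s-fixed {suc a} {0} (λ ()) (λ ()))))
s-punch-below {suc q} (suc a) (suc i) (s≤s p) =
  trans (s-suc a (punch q i))
        (trans (cong suc (s-punch-below a i p)) (sym (cong (punch (suc q)) (s-suc a i))))

-- Above the gap heights exceed ranks by one, hence the shift of the letter.
s-punch-above : ∀ {q} a i → q ≤ a → s (suc a) (punch q i) ≡ punch q (s a i)
s-punch-above {zero}  a       i       _       = s-suc a i
s-punch-above {suc q} (suc a) zero    (s≤s p) =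
  trans (s-fixed {suc (suc a)} {0} (λ ()) (λ ()))
        (sym (cong (punch (suc q)) (s-fixed {suc a} {0} (λ ()) (λ ()))))
s-punch-above {suc q} (suc a) (suc i) (s≤s p) =
  trans (s-suc (suc a) (punch q i))
        (trans (cong suc (s-punch-above a i p)) (sym (cong (punch (suc q)) (s-suc a i))))

-- The potential and its growth under one letter

lt : ℕ → ℕ → ℕ
lt x y = if x <ᵇ y then 1 else 0

lt-true : ∀ {x y} → x < y → lt x y ≡ 1
lt-true {x} {y} p with x <ᵇ y | <⇒<ᵇ p
... | true | _ = refl

lt-false : ∀ {x y} → y ≤ x → lt x y ≡ 0
lt-false {x} {y} p with x <ᵇ y | <ᵇ⇒< x y
... | false | _ = refl
... | true  | f = ⊥-elim (<⇒≱ (f _) p)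

lt≤1 : ∀ x y → lt x y ≤ 1
lt≤1 x y with x <ᵇ y
... | true  = s≤s z≤n
... | false = z≤n

s-≤suc : ∀ a x → s a x ≤ suc x
s-≤suc a x = go (sView a x)
  where
  go : ∀ {x y} → SView a x y → y ≤ suc x
  go lower       = ≤-refl
  go upper       = m≤n⇒m≤1+n (n≤1+n _)
  go (fixed _ _) = n≤1+n _

s-≤ : ∀ {a x} → x ≢ a → s a x ≤ x
s-≤ {a} {x} p = go p (sView a x)
  where
  go : ∀ {x y} → x ≢ a → SView a x y → y ≤ x
  go p lower       = ⊥-elim (p refl)
  go p upper       = n≤1+n _
  go p (fixed _ _) = ≤-refl

s-mono : ∀ {a x y} → x < y → ¬ (x ≡ a × y ≡ suc a) → s a x ≤ s a y
s-mono {a} {x} {y} = go (sView a x) (sView a y)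
  where
  go : ∀ {x y x′ y′} → SView a x x′ → SView a y y′ → x < y → ¬ (x ≡ a × y ≡ suc a) → x′ ≤ y′
  go lower       lower       x<y _ = ≤-refl
  go lower       upper       x<y n = ⊥-elim (n (refl , refl))
  go lower       (fixed _ _) x<y _ = x<y
  go upper       lower       x<y _ = n≤1+n _
  go upper       upper       x<y _ = ≤-refl
  go upper       (fixed _ _) x<y _ = ≤-trans (n≤1+n _) (<⇒≤ x<y)
  go (fixed _ _) lower       x<y _ = m≤n⇒m≤1+n (<⇒≤ x<y)
  go (fixed p _) upper       x<y _ = ≤-pred x<y
  go (fixed _ _) (fixed _ _) x<y _ = <⇒≤ x<y

-- An adjacent transposition reverses only the pair that it exchanges, so an indicator can grow only
-- in the excluded situation.
lt-s : ∀ {a x y} → x ≢ y → ¬ (y ≡ a × x ≡ suc a) → lt (s a x) (s a y) ≤ lt x y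
lt-s {a} {x} {y} x≢y n with x <? y
... | yes x<y = ≤-trans (lt≤1 (s a x) (s a y)) (≤-reflexive (sym (lt-true x<y)))
... | no  x≮y = ≤-trans (≤-reflexive (lt-false (s-mono y<x n))) z≤n
  where y<x = ≤∧≢⇒< (≮⇒≥ x≮y) (x≢y ∘ sym)

-- For a permutation which sends 1 to p and n - 2, n - 1, n to x, y, z.  One
-- letter raises the potential by at most one, so potential - 1 bounds the length of
-- every word of the permutation from below.
potential : (p x y z : ℕ) → ℕ
potential p x y z = p + (lt z y + lt z x)

-- A growing summand requires `p`, `y` or `x` respectively to lie at height `a`. These heights are
-- distinct, so at most one summand grows; the second alternative records which.
potential-step : ∀ a {p x y z} → p ≢ x → p ≢ y → p ≢ z → x ≢ y → x ≢ z → y ≢ z →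
  potential (s a p) (s a x) (s a y) (s a z) ≤ potential p x y z
  ⊎ (potential (s a p) (s a x) (s a y) (s a z) ≤ suc (potential p x y z)
     × (p ≡ a ⊎ (y ≡ a × z ≡ suc a) ⊎ (x ≡ a × z ≡ suc a)))
potential-step a {p} {x} {y} {z} p≢x p≢y p≢z x≢y x≢z y≢z =
  go (p ≟ a) (y ≟ a) (x ≟ a) (z ≟ suc a)
  where
  z≢y = y≢z ∘ sym
  z≢x = x≢z ∘ sym
  go : Dec (p ≡ a) → Dec (y ≡ a) → Dec (x ≡ a) → Dec (z ≡ suc a) →
    potential (s a p) (s a x) (s a y) (s a z) ≤ potential p x y z
    ⊎ (potential (s a p) (s a x) (s a y) (s a z) ≤ suc (potential p x y z)
       × (p ≡ a ⊎ (y ≡ a × z ≡ suc a) ⊎ (x ≡ a × z ≡ suc a)))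
  go (yes p≡a) _ _ _ = inj₂
    ( +-mono-≤ (s-≤suc a p) (+-mono-≤ (lt-s z≢y (λ e → p≢y (trans p≡a (sym (proj₁ e)))))
                                       (lt-s z≢x (λ e → p≢x (trans p≡a (sym (proj₁ e))))))
    , inj₁ p≡a)
  go (no p≢a) (yes y≡a) (yes x≡a) _ = ⊥-elim (x≢y (trans x≡a (sym y≡a)))
  go (no p≢a) (yes y≡a) (no x≢a) (yes z≡a) = inj₂
    ( ≤-trans (+-mono-≤ (s-≤ p≢a) (+-mono-≤ (lt≤1 (s a z) (s a y)) (lt-s z≢x (x≢a ∘ proj₁))))
              (≤-trans (≤-reflexive (+-suc p (lt z x)))
                       (s≤s (+-monoʳ-≤ p (m≤n+m (lt z x) (lt z y)))))
    , inj₂ (inj₁ (y≡a , z≡a)))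
  go (no p≢a) (no y≢a) (yes x≡a) (yes z≡a) = inj₂
    ( ≤-trans (+-mono-≤ (s-≤ p≢a) (+-mono-≤ (lt-s z≢y (y≢a ∘ proj₁)) (lt≤1 (s a z) (s a x))))
              (≤-trans (≤-reflexive (trans (cong (p +_) (+-comm (lt z y) 1)) (+-suc p (lt z y))))
                       (s≤s (+-monoʳ-≤ p (m≤m+n (lt z y) (lt z x)))))
    , inj₂ (inj₂ (x≡a , z≡a)))
  go (no p≢a) (no y≢a) (no x≢a) _ = inj₁
    (+-mono-≤ (s-≤ p≢a) (+-mono-≤ (lt-s z≢y (y≢a ∘ proj₁)) (lt-s z≢x (x≢a ∘ proj₁))))
  go (no p≢a) _ _ (no z≢a) = inj₁
    (+-mono-≤ (s-≤ p≢a) (+-mono-≤ (lt-s z≢y (z≢a ∘ proj₂)) (lt-s z≢x (z≢a ∘ proj₂))))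

-- A gap between the two values would put them at distance two, so both lie on the same side of it.
punch-adjacent : ∀ {q} i j → punch q j ≡ suc (punch q i) → j ≡ suc i × (q ≤ i ⊎ suc i < q)
punch-adjacent {q} i j e with i <? q | j <? q
... | yes i<q | yes j<q
  with refl ← trans (sym (punch-< j<q)) (trans e (cong suc (punch-< i<q))) = refl , inj₂ j<q
... | yes i<q | no j≮q
  with refl ← trans (sym (punch-≥ (≮⇒≥ j≮q))) (trans e (cong suc (punch-< i<q))) = ⊥-elim (j≮q i<q)
... | no i≮q | yes j<q
  with refl ← trans (sym (punch-< j<q)) (trans e (cong suc (punch-≥ (≮⇒≥ i≮q)))) =
  ⊥-elim (i≮q (≤-trans (n≤1+n _) (<⇒≤ j<q)))
... | no i≮q | no j≮q
  with refl ← trans (sym (punch-≥ (≮⇒≥ j≮q))) (trans e (cong suc (punch-≥ (≮⇒≥ i≮q)))) =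
  refl , inj₁ (≮⇒≥ i≮q)

s-< : ∀ {a x} → x < a → s a x ≡ x
s-< p = s-fixed (<⇒≢ p) (<⇒≢ (m≤n⇒m≤1+n p))

s-> : ∀ {a x} → suc a < x → s a x ≡ x
s-> p = s-fixed (>⇒≢ (<-trans (n<1+n _) p)) (>⇒≢ p)

==-refl : ∀ m → (m == m) ≡ true
==-refl m with m ≟ m
... | yes _ = refl
... | no ¬p = ⊥-elim (¬p refl)

==-≢ : ∀ {m n} → m ≢ n → (m == n) ≡ false
==-≢ {m} {n} m≢n with m ≟ n
... | yes p = ⊥-elim (m≢n p)
... | no _  = refl

-- Reduced words as paths of strand 1 with two crossings

module _ (k : ℕ) where

  -- Ranks among the strands other than 1 after `t` crossings. Strand `2 + i` starts with rank `i`,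
  -- so strands `n - 2`, `n - 1`, `n` start with ranks `k`, `1 + k`, `2 + k`.
  order : ℕ → ℕ → ℕ
  order 0             i = i
  order 1             i = s (suc k) i
  order (suc (suc _)) i = s k (s (suc k) i)

  -- Here n = 4 + k; strand 1 sits above q of the other strands, and t of the two crossings
  -- of strand n with n-1 and n-2 have been made.
  state : ℕ → ℕ → ℕ → ℕ
  state q t zero          = zero
  state q t (suc zero)    = suc q
  state q t (suc (suc i)) = suc (punch q (order t i))

  -- Unprimed crossings happen while strand 1 is below both crossing strands, primed ones after it
  -- has passed both; passing lowers their heights, and so the letter, by one.
  data Path : ℕ → ℕ → List ℕ → Set where
    start  : Path 0 0 []
    rise   : ∀ {q t u} → Path q t u → Path (suc q) t (suc q ∷ u)
    cross₁ : ∀ {q u} → q ≤ suc k → Path q 0 u → Path q 1 (3 + k ∷ u)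
    cross₁′ : ∀ {q u} → 3 + k ≤ q → Path q 0 u → Path q 1 (2 + k ∷ u)
    cross₂ : ∀ {q u} → q ≤ k → Path q 1 u → Path q 2 (2 + k ∷ u)
    cross₂′ : ∀ {q u} → 2 + k ≤ q → Path q 1 u → Path q 2 (1 + k ∷ u)

  evalWord-path : ∀ {q t u} → Path q t u → ∀ x → evalWord u x ≡ state q t x
  evalWord-path start zero          = refl
  evalWord-path start (suc zero)    = refl
  evalWord-path start (suc (suc i)) = refl
  evalWord-path (rise {q} {t} p) x = trans (cong (s (suc q)) (evalWord-path p x)) (go x)
    where
    go : ∀ x → s (suc q) (state q t x) ≡ state (suc q) t x
    go zero          = s-fixed {suc q} {0} (λ ()) (λ ())
    go (suc zero)    = s-lower (suc q)
    go (suc (suc i)) = trans (s-suc q (punch q (order t i))) (cong suc (s-punch q (order t i)))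
  evalWord-path (cross₁ {q} q≤ p) x = trans (cong (s (3 + k)) (evalWord-path p x)) (go x)
    where
    go : ∀ x → s (3 + k) (state q 0 x) ≡ state q 1 x
    go zero          = s-fixed {3 + k} {0} (λ ()) (λ ())
    go (suc zero)    = s-< (s≤s (s≤s q≤))
    go (suc (suc i)) = trans (s-suc (2 + k) (punch q i)) (cong suc (s-punch-above (suc k) i q≤))
  evalWord-path (cross₁′ {q} ≤q p) x = trans (cong (s (2 + k)) (evalWord-path p x)) (go x)
    where
    go : ∀ x → s (2 + k) (state q 0 x) ≡ state q 1 x
    go zero          = s-fixed {2 + k} {0} (λ ()) (λ ())
    go (suc zero)    = s-> (s≤s ≤q)
    go (suc (suc i)) = trans (s-suc (1 + k) (punch q i)) (cong suc (s-punch-below (suc k) i ≤q))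
  evalWord-path (cross₂ {q} q≤ p) x = trans (cong (s (2 + k)) (evalWord-path p x)) (go x)
    where
    go : ∀ x → s (2 + k) (state q 1 x) ≡ state q 2 x
    go zero          = s-fixed {2 + k} {0} (λ ()) (λ ())
    go (suc zero)    = s-< (s≤s (s≤s q≤))
    go (suc (suc i)) = trans (s-suc (1 + k) (punch q _)) (cong suc (s-punch-above k (order 1 i) q≤))
  evalWord-path (cross₂′ {q} ≤q p) x = trans (cong (s (1 + k)) (evalWord-path p x)) (go x)
    where
    go : ∀ x → s (1 + k) (state q 1 x) ≡ state q 2 x
    go zero          = s-fixed {1 + k} {0} (λ ()) (λ ())
    go (suc zero)    = s-> (s≤s ≤q)
    go (suc (suc i)) = trans (s-suc k (punch q _)) (cong suc (s-punch-below k (order 1 i) ≤q))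

  length-path : ∀ {q t u} → Path q t u → length u ≡ q + t
  length-path start           = refl
  length-path (rise p)        = cong suc (length-path p)
  length-path (cross₁ {q} _ p)  = trans (cong suc (length-path p)) (sym (+-suc q 0))
  length-path (cross₁′ {q} _ p) = trans (cong suc (length-path p)) (sym (+-suc q 0))
  length-path (cross₂ {q} _ p)  = trans (cong suc (length-path p)) (sym (+-suc q 1))
  length-path (cross₂′ {q} _ p) = trans (cong suc (length-path p)) (sym (+-suc q 1))

  letters-path : ∀ {q t u} → Path q t u → q ≤ 3 + k → All (λ a → 1 ≤ a × a < 4 + k) u
  letters-path start         _ = []
  letters-path (rise p)      l = (s≤s z≤n , s≤s l) ∷ letters-path p (<⇒≤ l)
  letters-path (cross₁ _ p)  l = (s≤s z≤n , ≤-refl) ∷ letters-path p l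
  letters-path (cross₁′ _ p) l = (s≤s z≤n , n≤1+n _) ∷ letters-path p l
  letters-path (cross₂ _ p)  l = (s≤s z≤n , n≤1+n _) ∷ letters-path p l
  letters-path (cross₂′ _ p) l = (s≤s z≤n , m≤n+m _ 2) ∷ letters-path p l

  order-1 : order 1 k ≡ k × order 1 (1 + k) ≡ 2 + k × order 1 (2 + k) ≡ 1 + k
  order-1 = s-< (n<1+n k) , s-lower (suc k) , s-upper (suc k)

  order-2 : ∀ t → order (2 + t) k ≡ 1 + k × order (2 + t) (1 + k) ≡ 2 + k × order (2 + t) (2 + k) ≡ k
  order-2 t with a , b , c ← order-1 =
    trans (cong (s k) a) (s-lower k) ,
    trans (cong (s k) b) (s-> (n<1+n (suc k))) ,
    trans (cong (s k) c) (s-upper k)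

  potentialOf : (ℕ → ℕ) → ℕ
  potentialOf f = potential (f 1) (f (2 + k)) (f (3 + k)) (f (4 + k))

  potentialOf-step : ∀ a u →
    potentialOf (evalWord (a ∷ u)) ≤ potentialOf (evalWord u)
    ⊎ (potentialOf (evalWord (a ∷ u)) ≤ suc (potentialOf (evalWord u))
       × (evalWord u 1 ≡ a
          ⊎ (evalWord u (3 + k) ≡ a × evalWord u (4 + k) ≡ suc a)
          ⊎ (evalWord u (2 + k) ≡ a × evalWord u (4 + k) ≡ suc a)))
  potentialOf-step a u = potential-step a
    (distinct λ ()) (distinct λ ()) (distinct λ ())
    (distinct (<⇒≢ ≤-refl)) (distinct (<⇒≢ (n≤1+n _))) (distinct (<⇒≢ ≤-refl))
    where
    distinct : ∀ {x y} → x ≢ y → evalWord u x ≢ evalWord u y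
    distinct x≢y = x≢y ∘ evalWord-injective u

  potentialOf-≤ : ∀ u → potentialOf (evalWord u) ≤ suc (length u)
  potentialOf-≤ [] = ≤-reflexive (cong suc
    (cong₂ _+_ (lt-false (n≤1+n (3 + k))) (lt-false (m≤n+m (2 + k) 2))))
  potentialOf-≤ (a ∷ u) with potentialOf-step a u
  ... | inj₁ h       = ≤-trans h (m≤n⇒m≤1+n (potentialOf-≤ u))
  ... | inj₂ (h , _) = ≤-trans h (s≤s (potentialOf-≤ u))

  -- The crossing strands must have consecutive ranks in the right order. For strands `n - 1` and
  -- `n` this holds only at `t = 0`, for `n - 2` and `n` only at `t = 1`; the sides allowed by
  -- `punch-adjacent` select the unprimed or the primed constructor.
  extend : ∀ {q t u} a → Path q t u →
    evalWord u 1 ≡ a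
    ⊎ (evalWord u (3 + k) ≡ a × evalWord u (4 + k) ≡ suc a)
    ⊎ (evalWord u (2 + k) ≡ a × evalWord u (4 + k) ≡ suc a) →
    ∃₂ λ q t → Path q t (a ∷ u)
  extend {q} {t} {u} a p (inj₁ e)
    with refl ← trans (sym e) (evalWord-path p 1) = suc q , t , rise p
  extend {q} {t} {u} a p (inj₂ (inj₁ (e , f))) = go t p refl
    (punch-adjacent _ _ (suc-injective
      (trans (sym (evalWord-path p (4 + k))) (trans f (cong suc (trans (sym e) (evalWord-path p (3 + k))))))))
    where
    go : ∀ t′ → Path q t′ u → t ≡ t′ →
      order t (2 + k) ≡ suc (order t (1 + k)) × (q ≤ order t (1 + k) ⊎ suc (order t (1 + k)) < q) →
      ∃₂ λ q t → Path q t (a ∷ u)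
    go 0 p refl (_ , inj₁ q≤) with refl ← trans (sym e) (trans (evalWord-path p (3 + k)) (cong suc (punch-≥ q≤))) =
      q , 1 , cross₁ q≤ p
    go 0 p refl (_ , inj₂ <q) with refl ← trans (sym e) (trans (evalWord-path p (3 + k)) (cong suc (punch-< (<⇒≤ <q)))) =
      q , 1 , cross₁′ <q p
    go 1 p refl (g , _) with _ , b , c ← order-1 =
      ⊥-elim (<⇒≢ (s≤s (n≤1+n _)) (trans (sym c) (trans g (cong suc b))))
    go (suc (suc t)) p refl (g , _) with _ , b , c ← order-2 t =
      ⊥-elim (<⇒≢ (m≤n+m _ 2) (trans (sym c) (trans g (cong suc b))))
  extend {q} {t} {u} a p (inj₂ (inj₂ (e , f))) = go t p refl
    (punch-adjacent _ _ (suc-injective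
      (trans (sym (evalWord-path p (4 + k))) (trans f (cong suc (trans (sym e) (evalWord-path p (2 + k))))))))
    where
    go : ∀ t′ → Path q t′ u → t ≡ t′ →
      order t (2 + k) ≡ suc (order t k) × (q ≤ order t k ⊎ suc (order t k) < q) →
      ∃₂ λ q t → Path q t (a ∷ u)
    go 0 p refl (g , _) = ⊥-elim (1+n≢n g)
    go 1 p refl (_ , r) with x , _ , _ ← order-1 | r
    ... | inj₁ q≤
      with refl ← trans (sym e) (trans (evalWord-path p (2 + k)) (cong suc (trans (punch-≥ q≤) (cong suc x)))) =
      q , 2 , cross₂ (subst (q ≤_) x q≤) p
    ... | inj₂ <q
      with refl ← trans (sym e) (trans (evalWord-path p (2 + k)) (cong suc (trans (punch-< (<⇒≤ <q)) x))) =
      q , 2 , cross₂′ (subst (λ i → suc i < q) x <q) p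
    go (suc (suc t)) p refl (g , _) with a , _ , c ← order-2 t =
      ⊥-elim (<⇒≢ (n≤1+n _) (trans (sym c) (trans g (cong suc a))))

  -- Equality in `potentialOf-≤` passes to the tail and forces the first letter to raise the
  -- potential, which makes it a rise or a crossing.
  path-of-potential : ∀ u → potentialOf (evalWord u) ≡ suc (length u) → ∃₂ λ q t → Path q t u
  path-of-potential []      _ = 0 , 0 , start
  path-of-potential (a ∷ u) h with potentialOf-step a u
  ... | inj₁ g = ⊥-elim (1+n≰n (≤-trans (≤-reflexive (sym h)) (≤-trans g (potentialOf-≤ u))))
  ... | inj₂ (g , e)
    with _ , _ , p ← path-of-potential u
           (≤-antisym (potentialOf-≤ u) (≤-pred (≤-trans (≤-reflexive (sym h)) g)))
    = extend a p e

  nw-values : nw (4 + k) (2 + k) ≡ 2 + k × nw (4 + k) (3 + k) ≡ 3 + k × nw (4 + k) (4 + k) ≡ 1 + k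
  nw-values = two , three , four
    where
    two : nw (4 + k) (2 + k) ≡ 2 + k
    two rewrite ==-refl (2 + k) = refl
    three : nw (4 + k) (3 + k) ≡ 3 + k
    three rewrite ==-≢ {3 + k} {2 + k} 1+n≢n | ==-refl (3 + k) = refl
    four : nw (4 + k) (4 + k) ≡ 1 + k
    four rewrite ==-≢ {4 + k} {2 + k} (>⇒≢ (n≤1+n _)) | ==-≢ {4 + k} {3 + k} 1+n≢n | ==-refl (4 + k) = refl

  nw-below : ∀ {i} → i < k → nw (4 + k) (2 + i) ≡ 1 + i
  nw-below {i} i<k
    rewrite ==-≢ {2 + i} {2 + k} (<⇒≢ (s≤s (s≤s i<k)))
          | ==-≢ {2 + i} {3 + k} (<⇒≢ (s≤s (s≤s (m≤n⇒m≤1+n i<k))))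
          | ==-≢ {2 + i} {4 + k} (<⇒≢ (s≤s (s≤s (m≤n⇒m≤1+n (m≤n⇒m≤1+n i<k))))) = refl

  -- Strand 1 contributes `n`, and the last value lies below the two before it. This is one more
  -- than the length `5 + k`, so the bound `potentialOf-≤` is attained.
  potentialOf-nw : potentialOf (nw (4 + k)) ≡ 6 + k
  potentialOf-nw with a , b , c ← nw-values rewrite a | b | c
    | lt-true {1 + k} {3 + k} (n≤1+n _) | lt-true {1 + k} {2 + k} ≤-refl = cong (4 +_) (+-comm k 2)

  nw-cases : ∀ {j} → j ≤ 2 + k →
    (j < k × nw (4 + k) (2 + j) ≡ 1 + j)
    ⊎ (j ≡ k × nw (4 + k) (2 + j) ≡ 2 + k)
    ⊎ (j ≡ 1 + k × nw (4 + k) (2 + j) ≡ 3 + k)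
    ⊎ (j ≡ 2 + k × nw (4 + k) (2 + j) ≡ 1 + k)
  nw-cases l with a , b , c ← nw-values | m≤n⇒m<n∨m≡n l
  ... | inj₂ refl = inj₂ (inj₂ (inj₂ (refl , c)))
  ... | inj₁ l with m≤n⇒m<n∨m≡n (≤-pred l)
  ...   | inj₂ refl = inj₂ (inj₂ (inj₁ (refl , b)))
  ...   | inj₁ l with m≤n⇒m<n∨m≡n (≤-pred l)
  ...     | inj₂ refl = inj₂ (inj₁ (refl , a))
  ...     | inj₁ l = inj₁ (l , nw-below l)

  state-nw : ∀ i → i < 3 + k → state (3 + k) 2 (2 + i) ≡ nw (4 + k) (2 + i)
  state-nw i l with a , b , c ← order-2 0 | nw-cases (≤-pred l)
  ... | inj₁ (i<k , e) = trans
    (cong suc (trans (cong (punch (3 + k)) (trans (cong (s k) (s-< (m≤n⇒m≤1+n i<k))) (s-< i<k))) (punch-< l))) (sym e)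
  ... | inj₂ (inj₁ (refl , e))        = trans (cong suc (trans (cong (punch (3 + k)) a) (punch-< (n≤1+n _)))) (sym e)
  ... | inj₂ (inj₂ (inj₁ (refl , e))) = trans (cong suc (trans (cong (punch (3 + k)) b) (punch-< ≤-refl))) (sym e)
  ... | inj₂ (inj₂ (inj₂ (refl , e))) = trans (cong suc (trans (cong (punch (3 + k)) c) (punch-< (m≤n+m _ 2)))) (sym e)

  evalWord-nw : ∀ {u} → Path (3 + k) 2 u → ∀ {x} → 1 ≤ x → x ≤ 4 + k → evalWord u x ≡ nw (4 + k) x
  evalWord-nw p {suc zero}    _ _       = evalWord-path p 1
  evalWord-nw p {suc (suc i)} _ (s≤s l) = trans (evalWord-path p (2 + i)) (state-nw i l)

  potentialOf-cong-nw : ∀ {f} → (∀ {x} → 1 ≤ x → x ≤ 4 + k → f x ≡ nw (4 + k) x) → potentialOf f ≡ 6 + k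
  potentialOf-cong-nw e
    rewrite e {1} (s≤s z≤n) (s≤s z≤n) | e {2 + k} (s≤s z≤n) (m≤n+m _ 2)
          | e {3 + k} (s≤s z≤n) (n≤1+n _) | e {4 + k} (s≤s z≤n) ≤-refl = potentialOf-nw

  -- The image of 1 fixes the final height of the path, and then the length fixes the number of
  -- crossings.
  path-of-reduced : ∀ u → (∀ {x} → 1 ≤ x → x ≤ 4 + k → evalWord u x ≡ nw (4 + k) x) →
    length u ≡ 5 + k → Path (3 + k) 2 u
  path-of-reduced u e l
    with q , t , p ← path-of-potential u (trans (potentialOf-cong-nw e) (sym (cong suc l)))
    with refl ← suc-injective (trans (sym (evalWord-path p 1)) (e (s≤s z≤n) (s≤s z≤n)))
    with refl ← +-cancelˡ-≡ k _ _ (trans (suc-injective (suc-injective (suc-injective (trans (sym (length-path p)) l)))) (+-comm 2 k))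
    = p

-- Moves between the words of the grid

Far : ℕ → ℕ → Set
Far a b = suc a < b ⊎ suc b < a

-- In `braid` the coincidence of letters is an equation rather than a repeated index, so that it can
-- be refuted arithmetically when the letters are sums.
data Move : List ℕ → List ℕ → Set where
  comm  : ∀ {a b u} → Far a b → Move (a ∷ b ∷ u) (b ∷ a ∷ u)
  braid : ∀ {a b c u} → c ≡ a → b ≡ suc a ⊎ a ≡ suc b → Move (a ∷ b ∷ c ∷ u) (b ∷ a ∷ b ∷ u)
  skip  : ∀ {a u v} → Move u v → Move (a ∷ u) (a ∷ v)

move-sym : ∀ {u v} → Move u v → Move v u
move-sym (comm (inj₁ p))          = comm (inj₂ p)
move-sym (comm (inj₂ p))          = comm (inj₁ p)
move-sym (braid refl (inj₁ refl)) = braid refl (inj₂ refl)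
move-sym (braid refl (inj₂ refl)) = braid refl (inj₁ refl)
move-sym (skip m)                 = skip (move-sym m)

==⇒≡ : ∀ {m n} → T (m == n) → m ≡ n
==⇒≡ {m} {n} t with m ≟ n
... | yes p = p

≡⇒== : ∀ {m n} → m ≡ n → T (m == n)
≡⇒== {m} refl rewrite ==-refl m = _

∈-if⁻ : ∀ {A : Set} b {x y : A} → x ∈ (if b then y ∷ [] else []) → T b × x ≡ y
∈-if⁻ true (here e) = _ , e

∈-if⁺ : ∀ {A : Set} b {x : A} → T b → x ∈ (if b then x ∷ [] else [])
∈-if⁺ true _ = here refl

oneMove⇒Move : ∀ u {v} → v ∈ oneMove u → Move u v
oneMove⇒Move (a ∷ u) v∈ with ∈-++⁻ (frontMoves (a ∷ u)) v∈
... | inj₂ v∈′ with _ , w∈ , refl ← ∈-map⁻ (a ∷_) v∈′ = skip (oneMove⇒Move u w∈)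
oneMove⇒Move (a ∷ b ∷ u) v∈ | inj₁ v∈′ with ∈-++⁻ (if farApart a b then (b ∷ a ∷ u) ∷ [] else []) v∈′
... | inj₁ c with t , refl ← ∈-if⁻ (farApart a b) c with Equivalence.to (T-∨ {suc a <ᵇ b}) t
...   | inj₁ l = comm (inj₁ (<ᵇ⇒< _ _ l))
...   | inj₂ l = comm (inj₂ (<ᵇ⇒< _ _ l))
oneMove⇒Move (a ∷ b ∷ c ∷ u) v∈ | inj₁ v∈′ | inj₂ d
  with t , refl ← ∈-if⁻ ((c == a) ∧ ((b == suc a) ∨ (a == suc b))) d
  with t₁ , t₂ ← Equivalence.to (T-∧ {c == a}) t
  with Equivalence.to (T-∨ {b == suc a}) t₂
... | inj₁ l = braid (==⇒≡ t₁) (inj₁ (==⇒≡ l))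
... | inj₂ l = braid (==⇒≡ t₁) (inj₂ (==⇒≡ l))

Move⇒oneMove : ∀ {u v} → Move u v → v ∈ oneMove u
Move⇒oneMove (comm {a} {b} f) = ∈-++⁺ˡ (∈-++⁺ˡ (∈-if⁺ (farApart a b) (Equivalence.from (T-∨ {suc a <ᵇ b}) (t f))))
  where
  t : Far a b → T (suc a <ᵇ b) ⊎ T (suc b <ᵇ a)
  t (inj₁ l) = inj₁ (<⇒<ᵇ l)
  t (inj₂ l) = inj₂ (<⇒<ᵇ l)
Move⇒oneMove (braid {a} {b} {c} {u} e f) =
  ∈-++⁺ˡ (∈-++⁺ʳ (if farApart a b then (b ∷ a ∷ c ∷ u) ∷ [] else [])
    (∈-if⁺ ((c == a) ∧ ((b == suc a) ∨ (a == suc b)))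
      (Equivalence.from (T-∧ {c == a}) (≡⇒== e , Equivalence.from (T-∨ {b == suc a}) (t f)))))
  where
  t : b ≡ suc a ⊎ a ≡ suc b → T (b == suc a) ⊎ T (a == suc b)
  t (inj₁ l) = inj₁ (≡⇒== l)
  t (inj₂ l) = inj₂ (≡⇒== l)
Move⇒oneMove (skip {a} {u} m) = ∈-++⁺ʳ (frontMoves (a ∷ u)) (∈-map⁺ (a ∷_) (Move⇒oneMove m))

far-irrefl-suc : ∀ {x} → ¬ Far (suc x) x
far-irrefl-suc (inj₁ p) = 1+n≰n (≤-trans (m≤n+m _ 2) p)
far-irrefl-suc (inj₂ p) = 1+n≰n p

far-irrefl-pred : ∀ {x} → ¬ Far x (suc x)
far-irrefl-pred (inj₁ p) = far-irrefl-suc (inj₂ p)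
far-irrefl-pred (inj₂ p) = far-irrefl-suc (inj₁ p)

-- The letters of `h` consecutive rises of strand 1 that start at `q = l`.
run : ℕ → ℕ → List ℕ
run zero    l = []
run (suc h) l = suc (h + l) ∷ run h l

down : ℕ → List ℕ
down zero    = []
down (suc a) = suc a ∷ down a

run-snoc : ∀ h l u → run h (suc l) ++ suc l ∷ u ≡ run (suc h) l ++ u
run-snoc zero    l u = refl
run-snoc (suc h) l u = cong₂ _∷_ (cong suc (+-suc h l)) (run-snoc h l u)

-- The letter `c` exceeds every letter of the two runs, so its first occurrence shows where each run
-- ends.
run-injective : ∀ g g′ {l l′ c u u′} → g + l ≡ g′ + l′ → g + l < c →
  run g l ++ c ∷ u ≡ run g′ l′ ++ c ∷ u′ → g ≡ g′ × u ≡ u′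
run-injective zero    zero     _ _ e = refl , ∷-injectiveʳ e
run-injective (suc g) zero     _ b e = ⊥-elim (<⇒≢ b (∷-injectiveˡ e))
run-injective zero    (suc g′) s b e = ⊥-elim (<⇒≢ b (trans s (sym (∷-injectiveˡ e))))
run-injective (suc g) (suc g′) s b e
  with p , q ← run-injective g g′ (suc-injective s) (<⇒≤ b) (∷-injectiveʳ e) = cong suc p , q

-- Neighbouring letters differ by one and letters two apart are distinct, so neither kind of move
-- applies.
down-rigid : ∀ a {v} → ¬ Move (down a) v
down-rigid (suc zero)          (skip ())
down-rigid (suc (suc zero))    (comm f)    = far-irrefl-suc f
down-rigid (suc (suc zero))    (skip m)    = down-rigid 1 m
down-rigid (suc (suc (suc a))) (comm f)    = far-irrefl-suc f
down-rigid (suc (suc (suc a))) (braid e _) = <⇒≢ (s≤s (s≤s (n≤1+n a))) e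
down-rigid (suc (suc (suc a))) (skip m)    = down-rigid (2 + a) m

move-run : ∀ h {l u v} → Move u v → Move (run h l ++ u) (run h l ++ v)
move-run zero    m = m
move-run (suc h) m = skip (move-run h m)

-- A run is rigid in itself and `c` is too large to braid with it, so a move that touches the run
-- can only exchange `c` with the lowest rise.
run-move : ∀ h {l c u v} → 2 + (h + l) ≤ c → Move (run h l ++ c ∷ u) v →
  (∃ λ u′ → Move (c ∷ u) u′ × v ≡ run h l ++ u′)
  ⊎ (∃ λ h′ → h ≡ suc h′ × v ≡ run h′ (suc l) ++ c ∷ suc l ∷ u)
run-move zero          b m                    = inj₁ (_ , m , refl)
run-move (suc zero)    b (comm _)             = inj₂ (0 , refl , refl)
run-move (suc zero)    b (braid _ (inj₁ e))   = ⊥-elim (>⇒≢ b e)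
run-move (suc zero)    b (braid _ (inj₂ e))   = ⊥-elim (<⇒≢ (≤-trans (n≤1+n _) (≤-trans b (n≤1+n _))) e)
run-move (suc zero)    b (skip m)             = inj₁ (_ , m , refl)
run-move (suc (suc zero)) b (comm f)          = ⊥-elim (far-irrefl-suc f)
run-move (suc (suc zero)) b (braid e _)       = ⊥-elim (>⇒≢ (≤-trans (n≤1+n _) b) e)
run-move (suc (suc zero)) b (skip m) with run-move 1 (<⇒≤ b) m
... | inj₁ (_ , m′ , refl)    = inj₁ (_ , m′ , refl)
... | inj₂ (_ , refl , refl) = inj₂ (1 , refl , refl)
run-move (suc (suc (suc h))) b (comm f)       = ⊥-elim (far-irrefl-suc f)
run-move (suc (suc (suc h))) b (braid e _)    = ⊥-elim (<⇒≢ (n≤1+n _) e)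
run-move (suc (suc (suc h))) {l} b (skip m) with run-move (2 + h) (<⇒≤ b) m
... | inj₁ (_ , m′ , refl)   = inj₁ (_ , m′ , refl)
... | inj₂ (_ , refl , refl) = inj₂ (2 + h , refl , cong₂ _∷_ (cong suc (sym (+-suc (suc h) l))) refl)

-- The triangular grid and its words

Tri : Set
Tri = ℕ × ℕ × ℕ

-- a, b = a + d and the total a + d + e are the coordinates of a triangular
-- piece 0 ≤ a ≤ b ≤ a + d + e of the square grid; steps are its unit steps.
data Step : Tri → Tri → Set where
  a⁺ : ∀ {a d e} → Step (a , suc d , e) (suc a , d , e)
  a⁻ : ∀ {a d e} → Step (suc a , d , e) (a , suc d , e)
  b⁺ : ∀ {a d e} → Step (a , d , suc e) (a , suc d , e)
  b⁻ : ∀ {a d e} → Step (a , suc d , e) (a , d , suc e)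

-- Summed in the order in which `word` splits on its coordinates, so that the weight reduces
-- together with the word.
weight : Tri → ℕ
weight (a , d , e) = e + (d + a)

step-weight : ∀ {p q} → Step p q → weight p ≡ weight q
step-weight (a⁺ {a} {d} {e}) = cong (e +_) (sym (+-suc d a))
step-weight (a⁻ {a} {d} {e}) = cong (e +_) (+-suc d a)
step-weight (b⁺ {a} {d} {e}) = sym (+-suc e (d + a))
step-weight (b⁻ {a} {d} {e}) = +-suc e (d + a)

module _ (k : ℕ) where

  -- Climb to `q = a`, make the first crossing there, then rise `h` times.
  lowerHalf : ℕ → ℕ → List ℕ
  lowerHalf h a = run h a ++ 3 + k ∷ down a

  -- With q as in state, the first crossing of this word occurs at q = a and the
  -- second one at q = d + a if e ≥ 2, at q = 2 + k if e = 1 and at q = 3 + k if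
  -- e = 0; (2 + k , 0 , 0) stands for both crossings at q = 3 + k.  The values
  -- 2 + k for the first and 1 + k for the second crossing do not occur, because
  -- strand 1 then separates the two strands.
  word : Tri → List ℕ
  word (a , d , suc (suc g)) = 3 + k ∷ 2 + k ∷ 1 + k ∷ run g (d + a) ++ 2 + k ∷ lowerHalf d a
  word (a , d , 1)           = 3 + k ∷ 1 + k ∷ 2 + k ∷ lowerHalf d a
  word (a , suc h , 0)       = 1 + k ∷ 3 + k ∷ 2 + k ∷ lowerHalf h a
  word (a , 0 , 0)           = 1 + k ∷ 2 + k ∷ 3 + k ∷ 2 + k ∷ down (1 + k)

  lowerHalf-injective : ∀ {h h′ a a′} → h + a ≡ h′ + a′ → h + a ≤ 1 + k →
    lowerHalf h a ≡ lowerHalf h′ a′ → h ≡ h′ × a ≡ a′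
  lowerHalf-injective {h} {h′} s b e
    with refl , _ ← run-injective h h′ s (s≤s (≤-trans b (n≤1+n _))) e = refl , +-cancelˡ-≡ h _ _ s

  private
    tail³ : ∀ {a b c} {u v : List ℕ} → _≡_ {A = List ℕ} (a ∷ b ∷ c ∷ u) (a ∷ b ∷ c ∷ v) → u ≡ v
    tail³ refl = refl

    peel : ∀ {m n} → suc (suc m) ≡ suc (suc n) → m ≡ n
    peel = suc-injective ∘ suc-injective

  -- The first two letters tell the four shapes apart. Within a shape the crossing letters exceed
  -- the runs before them, which locates both crossings.
  word-injective : ∀ p q → weight p ≡ 2 + k → weight q ≡ 2 + k → word p ≡ word q → p ≡ q
  word-injective (a , d , suc (suc g)) (a′ , d′ , suc (suc g′)) s s′ e
    with refl , e′ ← run-injective g g′ (peel (trans s (sym s′))) (≤-trans (≤-reflexive (cong suc (peel s))) (n≤1+n _)) (tail³ e)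
    with refl , refl ← lowerHalf-injective (+-cancelˡ-≡ g _ _ (peel (trans s (sym s′))))
                         (≤-trans (m≤n+m _ g) (≤-trans (≤-reflexive (peel s)) (n≤1+n _))) e′ = refl
  word-injective (a , d , suc (suc g)) (a′ , d′ , 1)           s s′ ()
  word-injective (a , d , suc (suc g)) (a′ , suc h′ , 0)       s s′ ()
  word-injective (a , d , suc (suc g)) (a′ , 0 , 0)            s s′ ()
  word-injective (a , d , 1)           (a′ , d′ , suc (suc g′)) s s′ ()
  word-injective (a , d , 1)           (a′ , d′ , 1)           s s′ e
    with refl , refl ← lowerHalf-injective (suc-injective (trans s (sym s′))) (≤-reflexive (suc-injective s)) (tail³ e) = refl
  word-injective (a , d , 1)           (a′ , suc h′ , 0)       s s′ ()
  word-injective (a , d , 1)           (a′ , 0 , 0)            s s′ ()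
  word-injective (a , suc h , 0)       (a′ , d′ , suc (suc g′)) s s′ ()
  word-injective (a , suc h , 0)       (a′ , d′ , 1)           s s′ ()
  word-injective (a , suc h , 0)       (a′ , suc h′ , 0)       s s′ e
    with refl , refl ← lowerHalf-injective (suc-injective (trans s (sym s′))) (≤-reflexive (suc-injective s)) (tail³ e) = refl
  word-injective (a , suc h , 0)       (a′ , 0 , 0)            s s′ ()
  word-injective (a , 0 , 0)           (a′ , d′ , suc (suc g′)) s s′ ()
  word-injective (a , 0 , 0)           (a′ , d′ , 1)           s s′ ()
  word-injective (a , 0 , 0)           (a′ , suc h′ , 0)       s s′ ()
  -- This word does not mention `a`; only the weight determines it.
  word-injective (a , 0 , 0)           (a′ , 0 , 0)            s s′ e = cong (_, 0 , 0) (trans s (sym s′))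

  path-down : ∀ a → Path k a 0 (down a)
  path-down zero    = start
  path-down (suc a) = rise (path-down a)

  path-run : ∀ h {q t u} → Path k q t u → Path k (h + q) t (run h q ++ u)
  path-run zero    p = p
  path-run (suc h) p = rise (path-run h p)

  path-lowerHalf : ∀ h {a} → a ≤ 1 + k → Path k (h + a) 1 (lowerHalf h a)
  path-lowerHalf h a≤ = path-run h (cross₁ a≤ (path-down _))

  path-cast : ∀ {q q′ t u} → q ≡ q′ → Path k q t u → Path k q′ t u
  path-cast refl p = p

  path-word : ∀ p → weight p ≡ 2 + k → Path k (3 + k) 2 (word p)
  path-word (a , d , suc (suc g)) s =
    rise (rise (rise (path-cast (peel s)
      (path-run g (cross₂ b (path-lowerHalf d (≤-trans (m≤n+m a d) (≤-trans b (n≤1+n k)))))))))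
    where
    b : d + a ≤ k
    b = ≤-trans (m≤n+m _ g) (≤-reflexive (peel s))
  path-word (a , d , 1) s =
    rise (cross₂′ ≤-refl (rise (path-cast b (path-lowerHalf d (≤-trans (m≤n+m a d) (≤-reflexive b))))))
    where b = suc-injective s
  path-word (a , suc h , 0) s =
    cross₂′ (n≤1+n _) (rise (rise (path-cast b (path-lowerHalf h (≤-trans (m≤n+m a h) (≤-reflexive b))))))
    where b = suc-injective s
  path-word (a , 0 , 0) s = cross₂′ (n≤1+n _) (cross₁′ ≤-refl (rise (rise (path-down (1 + k)))))

  path-0 : ∀ {q u} → Path k q 0 u → u ≡ down q
  path-0 start    = refl
  path-0 (rise p) = cong (_ ∷_) (path-0 p)

  -- The bound on `q` places a primed crossing at `q = 3 + k` and leaves no room for a rise after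
  -- it.
  path-1 : ∀ {q u} → Path k q 1 u → q ≤ 3 + k →
    (∃₂ λ h a → a ≤ 1 + k × h + a ≡ q × u ≡ lowerHalf h a) ⊎ (q ≡ 3 + k × u ≡ 2 + k ∷ down (3 + k))
  path-1 (cross₁ {q} b p)  l = inj₁ (0 , q , b , refl , cong (_ ∷_) (path-0 p))
  path-1 (cross₁′ b p)     l with refl ← ≤-antisym b l = inj₂ (refl , cong (_ ∷_) (path-0 p))
  path-1 (rise p)          l with path-1 p (<⇒≤ l)
  ... | inj₁ (h , a , b , refl , e) = inj₁ (suc h , a , b , refl , cong (_ ∷_) e)
  ... | inj₂ (refl , _)             = ⊥-elim (1+n≰n l)

  -- The alternatives are: both crossings unprimed, only the second one primed, both primed. A
  -- primed first crossing lies too high for an unprimed second one.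
  path-2 : ∀ {q u} → Path k q 2 u → q ≤ 3 + k →
    (∃₂ λ g h → ∃ λ a → h + a ≤ k × g + (h + a) ≡ q × u ≡ run g (h + a) ++ 2 + k ∷ lowerHalf h a)
    ⊎ (∃₂ λ g h → ∃ λ a → (a ≤ 1 + k × 2 + k ≤ h + a) × g + (h + a) ≡ q × u ≡ run g (h + a) ++ 1 + k ∷ lowerHalf h a)
    ⊎ (q ≡ 3 + k × u ≡ 1 + k ∷ 2 + k ∷ down (3 + k))
  path-2 (cross₂ b p) l with path-1 p l
  ... | inj₁ (h , a , _ , refl , e) = inj₁ (0 , h , a , b , refl , cong (_ ∷_) e)
  ... | inj₂ (refl , _)             = ⊥-elim (1+n≰n (≤-trans (m≤n+m (1 + k) 2) b))
  path-2 (cross₂′ b p) l with path-1 p l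
  ... | inj₁ (h , a , c , refl , e) = inj₂ (inj₁ (0 , h , a , (c , b) , refl , cong (_ ∷_) e))
  ... | inj₂ (refl , e)             = inj₂ (inj₂ (refl , cong (_ ∷_) e))
  path-2 (rise p) l with path-2 p (<⇒≤ l)
  ... | inj₁ (g , h , a , b , refl , e)        = inj₁ (suc g , h , a , b , refl , cong (_ ∷_) e)
  ... | inj₂ (inj₁ (g , h , a , b , refl , e)) = inj₂ (inj₁ (suc g , h , a , b , refl , cong (_ ∷_) e))
  ... | inj₂ (inj₂ (refl , _))                 = ⊥-elim (1+n≰n l)

  word-of-path : ∀ {u} → Path k (3 + k) 2 u → ∃ λ p → weight p ≡ 2 + k × u ≡ word p
  word-of-path p with path-2 p ≤-refl
  -- An unprimed second crossing leaves at least three rises, namely the letters `3 + k`, `2 + k`,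
  -- `1 + k` that `word` spells out.
  ... | inj₁ (0 , h , a , b , s , _) = ⊥-elim (<⇒≢ (≤-trans (s≤s b) (m≤n+m _ 2)) s)
  ... | inj₁ (1 , h , a , b , s , _) = ⊥-elim (<⇒≢ (≤-trans (s≤s b) (n≤1+n _)) (suc-injective s))
  ... | inj₁ (2 , h , a , b , s , _) = ⊥-elim (<⇒≢ (s≤s b) (peel s))
  ... | inj₁ (suc (suc (suc g)) , h , a , b , s , refl)
    with refl ← suc-injective (peel s) = (a , h , 2 + g) , refl , refl
  ... | inj₂ (inj₁ (0 , 0 , a , (c , _) , s , _)) = ⊥-elim (>⇒≢ (s≤s (≤-trans c (n≤1+n _))) (sym s))
  ... | inj₂ (inj₁ (0 , 1 , a , (c , _) , s , _)) = ⊥-elim (<⇒≢ (s≤s c) (suc-injective s))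
  ... | inj₂ (inj₁ (0 , suc (suc h) , a , _ , s , refl)) =
    (a , suc h , 0) , suc-injective s , cong (λ m → 1 + k ∷ 2 + m ∷ 1 + m ∷ lowerHalf h a) (peel s)
  ... | inj₂ (inj₁ (1 , 0 , a , (c , _) , s , _)) = ⊥-elim (<⇒≢ (s≤s c) (suc-injective s))
  ... | inj₂ (inj₁ (1 , suc h , a , _ , s , refl)) =
    (a , h , 1) , suc-injective s , cong (λ m → 2 + m ∷ 1 + k ∷ 1 + m ∷ lowerHalf h a) (peel s)
  ... | inj₂ (inj₁ (suc (suc g) , h , a , (_ , c) , s , _)) =
    ⊥-elim (<⇒≢ (s≤s (≤-trans c (m≤n+m _ g))) (sym (suc-injective s)))
  ... | inj₂ (inj₂ (_ , e)) = (2 + k , 0 , 0) , refl , e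

  swap-lowerHalf : ∀ h {a} → a ≤ k → Move (lowerHalf (suc h) a) (lowerHalf h (suc a))
  swap-lowerHalf h {a} b = subst (λ u → Move u (lowerHalf h (suc a))) (run-snoc h a (3 + k ∷ down a))
    (move-run h (comm (inj₁ (s≤s (s≤s (s≤s b))))))

  -- Both runs are rigid, so only the crossing letter `3 + k` can move, past the rise on either side
  -- of it.
  lowerHalf-move : ∀ h {a v} → h + a ≤ 1 + k → Move (lowerHalf h a) v →
    (∃ λ h′ → h ≡ suc h′ × v ≡ lowerHalf h′ (suc a)) ⊎ (∃ λ a′ → a ≡ suc a′ × v ≡ lowerHalf (suc h) a′)
  lowerHalf-move h {a} b m with run-move h {a} (s≤s (s≤s b)) m
  ... | inj₂ (h′ , refl , refl)   = inj₁ (h′ , refl , refl)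
  ... | inj₁ (_ , m′ , refl) = inj₂ (front a (≤-trans (m≤n+m a h) b) m′)
    where
    front : ∀ a {u} → a ≤ 1 + k → Move (3 + k ∷ down a) u →
      ∃ λ a′ → a ≡ suc a′ × run h a ++ u ≡ lowerHalf (suc h) a′
    front zero          _ (skip ())
    front (suc zero)    _ (comm _)    = 0 , refl , run-snoc h 0 (3 + k ∷ [])
    front (suc zero)    _ (skip m)    = ⊥-elim (down-rigid 1 m)
    front (suc (suc a)) _ (comm _)    = suc a , refl , run-snoc h (suc a) (3 + k ∷ down (suc a))
    front (suc (suc a)) b (braid e _) = ⊥-elim (<⇒≢ (≤-trans b (m≤n+m _ 2)) e)
    front (suc (suc a)) _ (skip m)    = ⊥-elim (down-rigid (2 + a) m)

  -- The third letter is never `2 + k`, which excludes a braid at the front. `Far` is kept in the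
  -- result because the shapes with `h + a = 1 + k` refute this alternative by it.
  upper-move : ∀ h {a v} → h + a ≤ 1 + k → Move (2 + k ∷ lowerHalf h a) v →
    (∃ λ h′ → Far (2 + k) (suc (h′ + a)) × h ≡ suc h′ × v ≡ suc (h′ + a) ∷ 2 + k ∷ lowerHalf h′ a)
    ⊎ (∃ λ v′ → Move (lowerHalf h a) v′ × v ≡ 2 + k ∷ v′)
  upper-move zero          {zero}  b (comm f)    = ⊥-elim (far-irrefl-pred f)
  upper-move zero          {zero}  b (skip m)    = inj₂ (_ , m , refl)
  upper-move zero          {suc a} b (comm f)    = ⊥-elim (far-irrefl-pred f)
  upper-move zero          {suc a} b (braid e _) = ⊥-elim (<⇒≢ (s≤s b) e)
  upper-move zero          {suc a} b (skip m)    = inj₂ (_ , m , refl)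
  upper-move (suc zero)    {a}     b (comm f)    = inj₁ (0 , f , refl , refl)
  upper-move (suc zero)    {a}     b (braid e _) = ⊥-elim (1+n≢n e)
  upper-move (suc zero)    {a}     b (skip m)    = inj₂ (_ , m , refl)
  upper-move (suc (suc h)) {a}     b (comm f)    = inj₁ (suc h , f , refl , refl)
  upper-move (suc (suc h)) {a}     b (braid e _) = ⊥-elim (<⇒≢ (≤-trans b (n≤1+n _)) e)
  upper-move (suc (suc h)) {a}     b (skip m)    = inj₂ (_ , m , refl)

  Next : Tri → List ℕ → Set
  Next p v = ∃ λ q → Step p q × v ≡ word q

  -- All positions of the four shapes are inspected. Braids survive only between `e = 2` and
  -- `e = 1`, where the second crossing skips `q = 1 + k`, and between `(1 + k , 1 , 0)` and
  -- `(2 + k , 0 , 0)`, where the first one skips `q = 2 + k`.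
  move⇒step : ∀ p {v} → weight p ≡ 2 + k → Move (word p) v → Next p v
  move⇒step (a , d , suc (suc g)) s (comm f)    = ⊥-elim (far-irrefl-suc f)
  move⇒step (a , d , suc (suc g)) s (braid () _)
  move⇒step (a , d , suc (suc g)) s (skip m)    = second g s m
    where
    inner : ∀ g {v} → g + (d + a) ≡ k → Move (run g (d + a) ++ 2 + k ∷ lowerHalf d a) v →
      Next (a , d , suc (suc g)) (3 + k ∷ 2 + k ∷ 1 + k ∷ v)
    inner g s m with run-move g (≤-reflexive (cong (2 +_) s)) m
    ... | inj₂ (g′ , refl , refl) = (a , suc d , 2 + g′) , b⁺ , refl
    ... | inj₁ (_ , m′ , refl) with upper-move d (≤-trans (≤-trans (m≤n+m _ g) (≤-reflexive s)) (n≤1+n k)) m′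
    ...   | inj₁ (d′ , _ , refl , refl) =
      (a , d′ , 3 + g) , b⁻ , cong (λ u → 3 + k ∷ 2 + k ∷ 1 + k ∷ u) (run-snoc g (d′ + a) _)
    ...   | inj₂ (_ , m″ , refl) with lowerHalf-move d (≤-trans (≤-trans (m≤n+m _ g) (≤-reflexive s)) (n≤1+n k)) m″
    ...     | inj₁ (d′ , refl , refl) = (suc a , d′ , 2 + g) , a⁺ ,
      cong (λ l → 3 + k ∷ 2 + k ∷ 1 + k ∷ run g l ++ 2 + k ∷ lowerHalf d′ (suc a)) (sym (+-suc d′ a))
    ...     | inj₂ (a′ , refl , refl) = (a′ , suc d , 2 + g) , a⁻ ,
      cong (λ l → 3 + k ∷ 2 + k ∷ 1 + k ∷ run g l ++ 2 + k ∷ lowerHalf (suc d) a′) (+-suc d a′)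
    second : ∀ g {v} → 2 + g + (d + a) ≡ 2 + k → Move (2 + k ∷ 1 + k ∷ run g (d + a) ++ 2 + k ∷ lowerHalf d a) v →
      Next (a , d , suc (suc g)) (3 + k ∷ v)
    third : ∀ g {v} → g + (d + a) ≡ k → Move (1 + k ∷ run g (d + a) ++ 2 + k ∷ lowerHalf d a) v →
      Next (a , d , suc (suc g)) (3 + k ∷ 2 + k ∷ v)
    second zero    s (comm f)    = ⊥-elim (far-irrefl-suc f)
    -- The factor `2 + k , 1 + k , 2 + k` becomes `1 + k , 2 + k , 1 + k`; since `d + a = k`, its
    -- last letter is now the top rise of `lowerHalf (suc d) a`.
    second zero    s (braid _ _) = (a , suc d , 1) , b⁺ ,
      cong (λ m → 3 + k ∷ 1 + k ∷ 2 + k ∷ 1 + m ∷ lowerHalf d a) (sym (peel s))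
    second zero    s (skip m)    = third zero (peel s) m
    second (suc g) s (comm f)    = ⊥-elim (far-irrefl-suc f)
    second (suc g) s (braid e _) = ⊥-elim (<⇒≢ (n≤1+n _) (trans (sym (peel s)) e))
    second (suc g) s (skip m)    = third (suc g) (peel s) m
    third zero          s m = third₀ d refl m
      where
      -- Splitting on `d` exposes the letter after `2 + k`: the first crossing if `d = 0`, a rise
      -- otherwise.
      third₀ : ∀ d′ {v} → d ≡ d′ → Move (1 + k ∷ 2 + k ∷ lowerHalf d′ a) v →
        Next (a , d , 2) (3 + k ∷ 2 + k ∷ v)
      third₀ zero     refl (comm f)     = ⊥-elim (far-irrefl-pred f)
      third₀ zero     refl (braid () _)
      third₀ zero     refl (skip m)     = inner zero s m
      third₀ (suc d′) refl (comm f)     = ⊥-elim (far-irrefl-pred f)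
      third₀ (suc d′) refl (braid e _)  = ⊥-elim (1+n≢n (trans (sym e) s))
      third₀ (suc d′) refl (skip m)     = inner zero s m
    third (suc zero)    s (comm f)     = ⊥-elim (far-irrefl-suc (subst (λ x → Far (1 + k) x) s f))
    third (suc zero)    s (braid () _)
    third (suc zero)    s (skip m)     = inner 1 s m
    third (suc (suc g)) s (comm f)     = ⊥-elim (far-irrefl-suc (subst (λ x → Far (1 + k) x) s f))
    third (suc (suc g)) s (braid e _)  = ⊥-elim (<⇒≢ (n≤1+n _) (trans e (cong suc (sym s))))
    third (suc (suc g)) s (skip m)     = inner (2 + g) s m
  move⇒step (a , d , 1) s (comm _)    = (a , suc d , 0) , b⁺ , refl
  move⇒step (a , d , 1) s (braid () _)
  move⇒step (a , d , 1) s (skip m)    = second d (suc-injective s) m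
    where
    second : ∀ d {v} → d + a ≡ 1 + k → Move (1 + k ∷ 2 + k ∷ lowerHalf d a) v → Next (a , d , 1) (3 + k ∷ v)
    rest : ∀ d {v} → d + a ≡ 1 + k → Move (2 + k ∷ lowerHalf d a) v → Next (a , d , 1) (3 + k ∷ 1 + k ∷ v)
    second zero    s (comm f)     = ⊥-elim (far-irrefl-pred f)
    second zero    s (braid () _)
    second zero    s (skip m)     = rest zero s m
    second (suc d) s (comm f)     = ⊥-elim (far-irrefl-pred f)
    second (suc d) s (braid _ _)  = (a , d , 2) , b⁻ , refl
    second (suc d) s (skip m)     = rest (suc d) s m
    rest d s m with upper-move d (≤-reflexive s) m
    -- Here the top rise is `1 + k`, which does not commute with `2 + k`.
    ... | inj₁ (d′ , f , refl , _) = ⊥-elim (far-irrefl-suc (subst (Far (2 + k)) s f))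
    ... | inj₂ (_ , m′ , refl) with lowerHalf-move d (≤-reflexive s) m′
    ...   | inj₁ (d′ , refl , refl) = (suc a , d′ , 1) , a⁺ , refl
    ...   | inj₂ (a′ , refl , refl) = (a′ , suc d , 1) , a⁻ , refl
  move⇒step (a , suc h , 0) s (comm _)    = (a , h , 1) , b⁻ , refl
  move⇒step (a , suc h , 0) s (braid () _)
  move⇒step (a , suc h , 0) s (skip m)    = second h (suc-injective s) m
    where
    second : ∀ h {v} → h + a ≡ 1 + k → Move (3 + k ∷ 2 + k ∷ lowerHalf h a) v → Next (a , suc h , 0) (1 + k ∷ v)
    rest : ∀ h {v} → h + a ≡ 1 + k → Move (2 + k ∷ lowerHalf h a) v → Next (a , suc h , 0) (1 + k ∷ 3 + k ∷ v)
    second zero    s (comm f)    = ⊥-elim (far-irrefl-suc f)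
    second zero    s (braid _ _) = (suc a , 0 , 0) , a⁺ ,
      cong (λ m → 1 + k ∷ 2 + k ∷ 3 + k ∷ 2 + k ∷ down m) s
    second zero    s (skip m)    = rest zero s m
    second (suc h) s (comm f)    = ⊥-elim (far-irrefl-suc f)
    second (suc h) s (braid e _) = ⊥-elim (<⇒≢ (n≤1+n _) (trans (sym s) e))
    second (suc h) s (skip m)    = rest (suc h) s m
    rest h s m with upper-move h (≤-reflexive s) m
    ... | inj₁ (h′ , f , refl , _) = ⊥-elim (far-irrefl-suc (subst (Far (2 + k)) s f))
    ... | inj₂ (_ , m′ , refl) with lowerHalf-move h (≤-reflexive s) m′
    ...   | inj₁ (h′ , refl , refl) = (suc a , suc h′ , 0) , a⁺ , refl
    ...   | inj₂ (a′ , refl , refl) = (a′ , suc (suc h) , 0) , a⁻ , refl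
  move⇒step (a , 0 , 0) s    (comm f)                     = ⊥-elim (far-irrefl-pred f)
  move⇒step (a , 0 , 0) s    (braid () _)
  move⇒step (a , 0 , 0) s    (skip (comm f))              = ⊥-elim (far-irrefl-pred f)
  move⇒step (a , 0 , 0) refl (skip (braid _ _))           = (1 + k , 1 , 0) , a⁻ , refl
  move⇒step (a , 0 , 0) s    (skip (skip (comm f)))       = ⊥-elim (far-irrefl-suc f)
  move⇒step (a , 0 , 0) s    (skip (skip (braid () _)))
  move⇒step (a , 0 , 0) s    (skip (skip (skip m)))       = ⊥-elim (down-rigid (2 + k) m)

  -- The steps `a⁺` and `b⁻` share the source `(a , suc d , e)` and are constructed; `a⁻` and `b⁺`
  -- are their inverses.
  step⇒move : ∀ {p q} → Step p q → weight p ≡ 2 + k → Move (word p) (word q)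
  a⁺⇒move : ∀ a d e → e + (suc d + a) ≡ 2 + k → Move (word (a , suc d , e)) (word (suc a , d , e))
  b⁻⇒move : ∀ a d e → e + (suc d + a) ≡ 2 + k → Move (word (a , suc d , e)) (word (a , d , suc e))
  step⇒move (a⁺ {a} {d} {e}) s = a⁺⇒move a d e s
  step⇒move (b⁻ {a} {d} {e}) s = b⁻⇒move a d e s
  step⇒move t@(a⁻ {a} {d} {e}) s = move-sym (a⁺⇒move a d e (trans (sym (step-weight t)) s))
  step⇒move t@(b⁺ {a} {d} {e}) s = move-sym (b⁻⇒move a d e (trans (sym (step-weight t)) s))

  a⁺⇒move a d (suc (suc g)) s = subst
    (λ l → Move (word (a , suc d , 2 + g)) (3 + k ∷ 2 + k ∷ 1 + k ∷ run g l ++ 2 + k ∷ lowerHalf d (suc a)))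
    (sym (+-suc d a))
    (skip (skip (skip (move-run g (skip (swap-lowerHalf d
      (≤-trans (m≤n+m a (suc d)) (≤-trans (m≤n+m _ g) (≤-reflexive (peel s))))))))))
  a⁺⇒move a d 1 s = skip (skip (skip (swap-lowerHalf d (≤-trans (m≤n+m a d) (≤-reflexive (peel s))))))
  a⁺⇒move a (suc d) 0 s = skip (skip (skip (swap-lowerHalf d (≤-trans (m≤n+m a d) (≤-reflexive (peel s))))))
  a⁺⇒move a 0 0 s = subst (λ m → Move (word (a , 1 , 0)) (1 + k ∷ 2 + k ∷ 3 + k ∷ 2 + k ∷ down m))
    (suc-injective s) (skip (braid refl (inj₂ refl)))

  b⁻⇒move a d (suc (suc g)) s = subst
    (λ u → Move (word (a , suc d , 2 + g)) (3 + k ∷ 2 + k ∷ 1 + k ∷ u))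
    (run-snoc g (d + a) _)
    (skip (skip (skip (move-run g (comm (inj₂ (s≤s (s≤s (≤-trans (m≤n+m _ g) (≤-reflexive (peel s)))))))))))
  b⁻⇒move a d 1 s = skip (braid (suc-injective s) (inj₁ refl))
  b⁻⇒move a d 0 s = comm (inj₁ ≤-refl)

-- Enumeration

-- The only tool for comparing enumerations: vertices, neighbours and closed walks are all counted
-- through it.
unique-sets-↭ : {xs ys : List X} → Unique xs → Unique ys →
  (∀ {x} → x ∈ xs → x ∈ ys) → (∀ {x} → x ∈ ys → x ∈ xs) → xs ↭ ys
unique-sets-↭ xs! ys! f g = ∼bag⇒↭ (unique∧set⇒bag xs! ys! (mk⇔ f g))

-- Injectivity is asked for on the list only, since `word` is injective only among triples of the
-- prescribed weight.
unique-map : (f : X → Y) {xs : List X} → (∀ {x y} → x ∈ xs → y ∈ xs → f x ≡ f y → x ≡ y) →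
  Unique xs → Unique (map f xs)
unique-map f inj []           = []
unique-map f inj (x∉ ∷ xs!) =
  All.map⁺ (All.tabulate λ y∈ e → All.lookup x∉ y∈ (inj (here refl) (there y∈) e))
  ∷ unique-map f (λ x∈ y∈ → inj (there x∈) (there y∈)) xs!

count-map : (p : Y → Bool) (f : X → Y) (xs : List X) → count p (map f xs) ≡ count (p ∘ f) xs
count-map p f []       = refl
count-map p f (x ∷ xs) with p (f x)
... | true  = cong suc (count-map p f xs)
... | false = count-map p f xs

count-++ : (p : X → Bool) (xs ys : List X) → count p (xs ++ ys) ≡ count p xs + count p ys
count-++ p xs ys = trans (cong length (filter-++ (T? ∘ p) xs ys)) (length-++ (filterᵇ p xs))

count-↭ : (p : X → Bool) {xs ys : List X} → xs ↭ ys → count p xs ≡ count p ys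
count-↭ p e = ↭-length (filter-↭ (T? ∘ p) e)

count-all : (p : X → Bool) {xs : List X} → All (T ∘ p) xs → count p xs ≡ length xs
count-all p ps = cong length (filter-all (T? ∘ p) ps)

count-none : (p : X → Bool) {xs : List X} → All (¬_ ∘ T ∘ p) xs → count p xs ≡ 0
count-none p ps = cong length (filter-none (T? ∘ p) ps)

count-accept : (p : X → Bool) {x : X} {xs : List X} → T (p x) → count p (x ∷ xs) ≡ suc (count p xs)
count-accept p t = cong length (filter-accept (T? ∘ p) t)

count-reject : (p : X → Bool) {x : X} {xs : List X} → ¬ T (p x) → count p (x ∷ xs) ≡ count p xs
count-reject p t = cong length (filter-reject (T? ∘ p) t)

-- Peels one loop off the nested enumeration in `fourCycles`; applied three times, it yields a
-- single count over quadruples.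
length-concatMap-cartesianProduct : (F : X → List Z) (p : X × Y → Bool) (ys : List Y) →
  (∀ x → length (F x) ≡ count (λ y → p (x , y)) ys) →
  ∀ xs → length (concatMap F xs) ≡ count p (cartesianProduct xs ys)
length-concatMap-cartesianProduct F p ys h []       = refl
length-concatMap-cartesianProduct F p ys h (x ∷ xs) = begin
  length (F x ++ concatMap F xs)
    ≡⟨ length-++ (F x) ⟩
  length (F x) + length (concatMap F xs)
    ≡⟨ cong₂ _+_ (h x) (length-concatMap-cartesianProduct F p ys h xs) ⟩
  count (λ y → p (x , y)) ys + count p (cartesianProduct xs ys)
    ≡⟨ cong (_+ count p (cartesianProduct xs ys)) (count-map p (x ,_) ys) ⟨
  count p (map (x ,_) ys) + count p (cartesianProduct xs ys)
    ≡⟨ count-++ p (map (x ,_) ys) _ ⟨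
  count p (cartesianProduct (x ∷ xs) ys) ∎
  where open ≡-Reasoning

length-cartesianProduct : (xs : List X) (ys : List Y) →
  length (cartesianProduct xs ys) ≡ length xs * length ys
length-cartesianProduct []       ys = refl
length-cartesianProduct (x ∷ xs) ys = trans (length-++ (map (x ,_) ys))
  (cong₂ _+_ (length-map (x ,_) ys) (length-cartesianProduct xs ys))

length-range : ∀ a j → length (range a j) ≡ j
length-range a zero    = refl
length-range a (suc j) = cong suc (length-range (suc a) j)

∈-range⁻ : ∀ {x} a j → x ∈ range a j → a ≤ x × x < a + j
∈-range⁻ a (suc j) (here refl) = ≤-refl , m<m+n a (s≤s z≤n)
∈-range⁻ a (suc j) (there p) with l , u ← ∈-range⁻ (suc a) j p =
  <⇒≤ l , ≤-trans u (≤-reflexive (sym (+-suc a j)))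

∈-range⁺ : ∀ {x} a j → a ≤ x → x < a + j → x ∈ range a j
∈-range⁺ a zero    l u = ⊥-elim (<⇒≱ (≤-trans u (≤-reflexive (+-identityʳ a))) l)
∈-range⁺ a (suc j) l u with m≤n⇒m<n∨m≡n l
... | inj₁ l′   = there (∈-range⁺ (suc a) j l′ (≤-trans u (≤-reflexive (+-suc a j))))
... | inj₂ refl = here refl

unique-range : ∀ a j → Unique (range a j)
unique-range a zero    = []
unique-range a (suc j) = All.tabulate (λ p → <⇒≢ (proj₁ (∈-range⁻ (suc a) j p))) ∷ unique-range (suc a) j

range-++ : ∀ a j l → range a (j + l) ≡ range a j ++ range (j + a) l
range-++ a zero    l = refl
range-++ a (suc j) l = cong (a ∷_) (trans (range-++ (suc a) j l) (cong (λ x → range (suc a) j ++ range x l) (+-suc j a)))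

words-suc : ∀ p m → words (suc p) m ≡ cartesianProductWith _∷_ (range 1 m) (words p m)
words-suc p m = go (range 1 m)
  where
  go : ∀ as → concatMap (λ a → map (a ∷_) (words p m)) as ≡ cartesianProductWith _∷_ as (words p m)
  go []       = refl
  go (a ∷ as) = cong (map (a ∷_) (words p m) ++_) (go as)

unique-words : ∀ p m → Unique (words p m)
unique-words zero    m = [] ∷ []
unique-words (suc p) m = subst Unique (sym (words-suc p m))
  (Unique.cartesianProductWith⁺ _∷_ ∷-injective (unique-range 1 m) (unique-words p m))

∈-words⁺ : ∀ {m u} → All (λ a → 1 ≤ a × a < suc m) u → u ∈ words (length u) m
∈-words⁺ []                  = here refl
∈-words⁺ {m} {a ∷ u} ((l , h) ∷ ps) = subst ((a ∷ u) ∈_) (sym (words-suc (length u) m))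
  (∈-cartesianProductWith⁺ _∷_ (∈-range⁺ 1 m l h) (∈-words⁺ ps))

splits : ℕ → List (ℕ × ℕ)
splits zero    = (0 , 0) ∷ []
splits (suc n) = (0 , suc n) ∷ map (λ (a , d) → suc a , d) (splits n)

-- Listed in layers of constant `e`, because the degree depends on `e` only through its being zero
-- or not.
triples : ℕ → List Tri
triples zero    = (0 , 0 , 0) ∷ []
triples (suc n) = map (λ (a , d) → a , d , 0) (splits (suc n)) ++ map (λ (a , d , e) → a , d , suc e) (triples n)

∈-splits⁺ : ∀ a d → (a , d) ∈ splits (d + a)
∈-splits⁺ zero    d rewrite +-identityʳ d with d
... | zero  = here refl
... | suc _ = here refl
∈-splits⁺ (suc a) d rewrite +-suc d a = there (∈-map⁺ _ (∈-splits⁺ a d))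

∈-splits⁻ : ∀ n {a d} → (a , d) ∈ splits n → d + a ≡ n
∈-splits⁻ zero    (here refl) = refl
∈-splits⁻ (suc n) (here refl) = +-identityʳ _
∈-splits⁻ (suc n) (there p) with (a , d) , q , refl ← ∈-map⁻ _ p = trans (+-suc d a) (cong suc (∈-splits⁻ n q))

∈-triples⁺ : ∀ p → p ∈ triples (weight p)
∈-triples⁺ (a , d , suc e) = ∈-++⁺ʳ (map _ (splits (suc (e + (d + a))))) (∈-map⁺ _ (∈-triples⁺ (a , d , e)))
∈-triples⁺ (a , d , zero) = go (d + a) (∈-splits⁺ a d)
  where
  go : ∀ n → (a , d) ∈ splits n → (a , d , 0) ∈ triples n
  go zero    (here refl) = here refl
  go (suc n) p           = ∈-++⁺ˡ (∈-map⁺ _ p)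

∈-triples⁻ : ∀ n {p} → p ∈ triples n → weight p ≡ n
∈-triples⁻ zero    (here refl) = refl
∈-triples⁻ (suc n) p with ∈-++⁻ (map _ (splits (suc n))) p
... | inj₁ q with _ , r , refl ← ∈-map⁻ _ q = ∈-splits⁻ (suc n) r
... | inj₂ q with _ , r , refl ← ∈-map⁻ _ q = cong suc (∈-triples⁻ n r)

unique-splits : ∀ n → Unique (splits n)
unique-splits zero    = [] ∷ []
unique-splits (suc n) =
  All.map⁺ (All.tabulate λ _ ()) ∷ Unique.map⁺ (λ { refl → refl }) (unique-splits n)

unique-triples : ∀ n → Unique (triples n)
unique-triples zero    = [] ∷ []
unique-triples (suc n) = Unique.++⁺
  (Unique.map⁺ (λ { refl → refl }) (unique-splits (suc n)))
  (Unique.map⁺ (λ { refl → refl }) (unique-triples n))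
  λ (p , q) → disjoint p q
  where
  disjoint : ∀ {t} → t ∈ map (λ (a , d) → a , d , 0) (splits (suc n)) →
             t ∈ map (λ (a , d , e) → a , d , suc e) (triples n) → ⊥
  disjoint p q with _ , _ , refl ← ∈-map⁻ _ p with _ , _ , () ← ∈-map⁻ _ q

length-splits : ∀ n → length (splits n) ≡ suc n
length-splits zero    = refl
length-splits (suc n) = cong suc (trans (length-map _ (splits n)) (length-splits n))

C2-suc : ∀ n → suc n C 2 ≡ n + n C 2
C2-suc n = trans (sym (nCk+nC[k+1]≡[n+1]C[k+1] n 1)) (cong (_+ n C 2) (nC1≡n n))

length-triples : ∀ n → length (triples n) ≡ (2 + n) C 2
length-triples zero    = refl
length-triples (suc n) = trans (length-++ (map _ (splits (suc n))))
  (trans (cong₂ _+_ (trans (length-map _ (splits (suc n))) (length-splits (suc n)))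
                    (trans (length-map _ (triples n)) (length-triples n)))
         (sym (C2-suc (2 + n))))

neighbours : Tri → List Tri
neighbours (a , d , e) = along-a a ++ inward d ++ along-b e
  where
  along-a : ℕ → List Tri
  along-a zero    = []
  along-a (suc a) = (a , suc d , e) ∷ []
  inward : ℕ → List Tri
  inward zero    = []
  inward (suc d) = (suc a , d , e) ∷ (a , d , suc e) ∷ []
  along-b : ℕ → List Tri
  along-b zero    = []
  along-b (suc e) = (a , suc d , e) ∷ []

∈-neighbours⁺ : ∀ {p q} → Step p q → q ∈ neighbours p
∈-neighbours⁺ (a⁺ {zero})                  = here refl
∈-neighbours⁺ (a⁺ {suc a})                 = there (here refl)
∈-neighbours⁺ a⁻                           = here refl
∈-neighbours⁺ (b⁺ {zero}  {zero})          = here refl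
∈-neighbours⁺ (b⁺ {zero}  {suc d})         = there (there (here refl))
∈-neighbours⁺ (b⁺ {suc a} {zero})          = there (here refl)
∈-neighbours⁺ (b⁺ {suc a} {suc d})         = there (there (there (here refl)))
∈-neighbours⁺ (b⁻ {zero})                  = there (here refl)
∈-neighbours⁺ (b⁻ {suc a})                 = there (there (here refl))

∈-neighbours⁻ : ∀ p {q} → q ∈ neighbours p → Step p q
∈-neighbours⁻ (zero  , zero  , suc e) (here refl)                         = b⁺
∈-neighbours⁻ (zero  , suc d , zero)  (here refl)                         = a⁺
∈-neighbours⁻ (zero  , suc d , zero)  (there (here refl))                 = b⁻
∈-neighbours⁻ (zero  , suc d , suc e) (here refl)                         = a⁺
∈-neighbours⁻ (zero  , suc d , suc e) (there (here refl))                 = b⁻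
∈-neighbours⁻ (zero  , suc d , suc e) (there (there (here refl)))         = b⁺
∈-neighbours⁻ (suc a , d     , e)     (here refl)                         = a⁻
∈-neighbours⁻ (suc a , zero  , suc e) (there (here refl))                 = b⁺
∈-neighbours⁻ (suc a , suc d , e)     (there (here refl))                 = a⁺
∈-neighbours⁻ (suc a , suc d , e)     (there (there (here refl)))         = b⁻
∈-neighbours⁻ (suc a , suc d , suc e) (there (there (there (here refl)))) = b⁺

unique-neighbours : ∀ p → Unique (neighbours p)
unique-neighbours (zero  , zero  , zero)  = []
unique-neighbours (zero  , zero  , suc e) = [] ∷ []
unique-neighbours (zero  , suc d , zero)  = ((λ ()) ∷ []) ∷ [] ∷ []
unique-neighbours (zero  , suc d , suc e) = ((λ ()) ∷ (λ ()) ∷ []) ∷ ((λ ()) ∷ []) ∷ [] ∷ []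
unique-neighbours (suc a , zero  , zero)  = [] ∷ []
unique-neighbours (suc a , zero  , suc e) = ((λ ()) ∷ []) ∷ [] ∷ []
unique-neighbours (suc a , suc d , zero)  = ((λ ()) ∷ (λ ()) ∷ []) ∷ ((λ ()) ∷ []) ∷ [] ∷ []
unique-neighbours (suc a , suc d , suc e) =
  ((λ ()) ∷ (λ ()) ∷ (λ ()) ∷ []) ∷ ((λ ()) ∷ (λ ()) ∷ []) ∷ ((λ ()) ∷ []) ∷ [] ∷ []

-- Degrees and squares of the grid

positive : ℕ → ℕ
positive zero    = 0
positive (suc _) = 1

gridDegree : Tri → ℕ
gridDegree (a , d , e) = positive e + (2 * positive d + positive a)

length-neighbours : ∀ p → length (neighbours p) ≡ gridDegree p
length-neighbours (zero  , zero  , zero)  = refl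
length-neighbours (zero  , zero  , suc e) = refl
length-neighbours (zero  , suc d , zero)  = refl
length-neighbours (zero  , suc d , suc e) = refl
length-neighbours (suc a , zero  , zero)  = refl
length-neighbours (suc a , zero  , suc e) = refl
length-neighbours (suc a , suc d , zero)  = refl
length-neighbours (suc a , suc d , suc e) = refl

-- The degrees of the triples (a , d , e) with a + d ≡ suc j, where x = positive e.
columnDegrees : ℕ → ℕ → List ℕ
columnDegrees x j = x + 2 ∷ replicate j (x + 3) ++ x + 1 ∷ []

-- The degrees of the triples with positive `e` and weight one more than the argument, layer by
-- layer. Every layer has `positive e = 1`; the last one is the single corner of degree 1.
interiorDegrees : ℕ → List ℕ
interiorDegrees zero    = 1 ∷ []
interiorDegrees (suc j) = columnDegrees 1 j ++ interiorDegrees j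

map-splits : ∀ x j → map (λ (a , d) → x + (2 * positive d + positive a)) (splits (suc j)) ≡ columnDegrees x j
map-splits x j = cong (x + 2 ∷_) (trans (sym (map-∘ (splits j))) (go j))
  where
  go : ∀ j → map (λ (a , d) → x + (2 * positive d + 1)) (splits j) ≡ replicate j (x + 3) ++ x + 1 ∷ []
  go zero    = refl
  go (suc j) = cong (x + 3 ∷_) (trans (sym (map-∘ (splits j))) (go j))

map-triples : ∀ n → map (λ (a , d , e) → 1 + (2 * positive d + positive a)) (triples n) ≡ interiorDegrees n
map-triples zero    = refl
map-triples (suc n) = trans (map-++ _ (map _ (splits (suc n))) (map _ (triples n)))
  (cong₂ _++_ (trans (sym (map-∘ (splits (suc n)))) (map-splits 1 n))
              (trans (sym (map-∘ (triples n))) (map-triples n)))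

map-gridDegree : ∀ n → map gridDegree (triples (suc n)) ≡ columnDegrees 0 n ++ interiorDegrees n
map-gridDegree n = trans (map-++ gridDegree (map _ (splits (suc n))) (map _ (triples n)))
  (cong₂ _++_ (trans (sym (map-∘ (splits (suc n)))) (map-splits 0 n))
              (trans (sym (map-∘ (triples n))) (map-triples n)))

count-replicate-≡ : ∀ v j xs → count (_== v) (replicate j v ++ xs) ≡ j + count (_== v) xs
count-replicate-≡ v zero    xs = refl
count-replicate-≡ v (suc j) xs rewrite ==-refl v = cong suc (count-replicate-≡ v j xs)

count-replicate-≢ : ∀ {v w} j xs → w ≢ v → count (_== v) (replicate j w ++ xs) ≡ count (_== v) xs
count-replicate-≢ zero    xs w≢v = refl
count-replicate-≢ (suc j) xs w≢v rewrite ==-≢ w≢v = count-replicate-≢ j xs w≢v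

count-interior : ∀ j →
  count (_== 0) (interiorDegrees j) ≡ 0 ×
  count (_== 1) (interiorDegrees j) ≡ 1 ×
  count (_== 2) (interiorDegrees j) ≡ j ×
  count (_== 3) (interiorDegrees j) ≡ j ×
  count (_== 4) (interiorDegrees j) ≡ j C 2 ×
  (∀ i → count (_== 5 + i) (interiorDegrees j) ≡ 0)
count-interior zero = refl , refl , refl , refl , refl , λ _ → refl
count-interior (suc j) with c₀ , c₁ , c₂ , c₃ , c₄ , c₅ ← count-interior j =
  trans (step 0 λ ()) c₀ ,
  trans (step 1 λ ()) c₁ ,
  trans (step 2 λ ()) (cong suc c₂) ,
  cong suc (trans (step 3 λ ()) c₃) ,
  trans (cong (count (_== 4)) (++-assoc (replicate j 4) (2 ∷ []) (interiorDegrees j)))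
    (trans (count-replicate-≡ 4 j (2 ∷ interiorDegrees j)) (trans (cong (j +_) c₄) (sym (C2-suc j)))) ,
  λ i → trans (step (5 + i) λ ()) (c₅ i)
  where
  step : ∀ v → 4 ≢ v → count (_== v) ((replicate j 4 ++ 2 ∷ []) ++ interiorDegrees j) ≡ count (_== v) (2 ∷ interiorDegrees j)
  step v 4≢v = trans (cong (count (_== v)) (++-assoc (replicate j 4) (2 ∷ []) (interiorDegrees j)))
    (count-replicate-≢ j (2 ∷ interiorDegrees j) 4≢v)

count-degrees : ∀ k v → count (_== v) (columnDegrees 0 (suc k) ++ interiorDegrees (suc k)) ≡ rhsCoeff (4 + k) v
count-degrees k v with c₀ , c₁ , c₂ , c₃ , c₄ , c₅ ← count-interior (suc k) = go v
  where
  assoc : ∀ v → count (_== v) ((replicate k 3 ++ 1 ∷ []) ++ interiorDegrees (suc k)) ≡ count (_== v) (replicate k 3 ++ 1 ∷ interiorDegrees (suc k))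
  assoc v = cong (count (_== v)) (++-assoc (replicate k 3) (1 ∷ []) (interiorDegrees (suc k)))
  step : ∀ v → 3 ≢ v → count (_== v) ((replicate k 3 ++ 1 ∷ []) ++ interiorDegrees (suc k)) ≡ count (_== v) (1 ∷ interiorDegrees (suc k))
  step v 3≢v = trans (assoc v) (count-replicate-≢ k (1 ∷ interiorDegrees (suc k)) 3≢v)
  go : ∀ v → count (_== v) (columnDegrees 0 (suc k) ++ interiorDegrees (suc k)) ≡ rhsCoeff (4 + k) v
  go 0 = trans (step 0 λ ()) c₀
  go 1 = trans (step 1 λ ()) (cong suc c₁)
  go 2 = cong suc (trans (step 2 λ ()) c₂)
  -- The outer `suc` is the first entry of `replicate (suc k) 3`, already evaluated.
  go 3 = trans (cong suc (trans (assoc 3) (trans (count-replicate-≡ 3 k _) (cong (k +_) c₃))))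
    (sym (trans (cong (_∸ 6) (eq k)) (m+n∸m≡n 6 (suc k + suc k))))
    where
    eq : ∀ k → 2 * (4 + k) ≡ 6 + (suc k + suc k)
    eq = solve-∀
  go 4 = trans (step 4 λ ()) c₄
  go (suc (suc (suc (suc (suc i))))) = trans (step (5 + i) λ ()) (c₅ i)

sum-replicate : ∀ j v xs → sum (replicate j v ++ xs) ≡ j * v + sum xs
sum-replicate zero    v xs = refl
sum-replicate (suc j) v xs = trans (cong (v +_) (sum-replicate j v xs)) (sym (+-assoc v (j * v) (sum xs)))

sum-columnDegrees : ∀ x j xs → sum (columnDegrees x j ++ xs) ≡ x + 2 + (j * (x + 3) + (x + 1 + sum xs))
sum-columnDegrees x j xs = cong (x + 2 +_)
  (trans (cong sum (++-assoc (replicate j (x + 3)) (x + 1 ∷ []) xs)) (sum-replicate j (x + 3) _))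

-- The closed form collects one entry 1, `j` entries 2, `j` entries 3 and `j C 2` entries 4.
sum-interiorDegrees : ∀ j → sum (interiorDegrees j) ≡ 1 + 5 * j + 4 * (j C 2)
sum-interiorDegrees zero    = refl
sum-interiorDegrees (suc j) = trans (sum-columnDegrees 1 j (interiorDegrees j))
  (trans (cong (λ x → 3 + (j * 4 + (2 + x))) (sum-interiorDegrees j))
    (trans (eq j (j C 2)) (cong (λ x → 1 + 5 * suc j + 4 * x) (sym (C2-suc j)))))
  where
  eq : ∀ j c → 3 + (j * 4 + (2 + (1 + 5 * j + 4 * c))) ≡ 1 + 5 * suc j + 4 * (j + c)
  eq = solve-∀

sum-degrees : ∀ j → sum (columnDegrees 0 j ++ interiorDegrees j) ≡ 4 * ((2 + j) C 2)
sum-degrees j = trans (sum-columnDegrees 0 j (interiorDegrees j))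
  (trans (cong (λ x → 2 + (j * 3 + (1 + x))) (sum-interiorDegrees j))
    (trans (eq j (j C 2)) (cong (4 *_) (sym (trans (C2-suc (suc j)) (cong (suc j +_) (C2-suc j)))))))
  where
  eq : ∀ j c → 2 + (j * 3 + (1 + (1 + 5 * j + 4 * c))) ≡ 4 * (suc j + (j + c))
  eq = solve-∀

-- Four-cycles of the grid as unit squares

Quad : Set → Set
Quad X = X × X × X × X

mapQuad : (X → Y) → Quad X → Quad Y
mapQuad f (p , q , r , s) = f p , f q , f r , f s

-- The flags raise `a` and `b`. A full square needs `d` and `e` positive at its lowest corner;
-- removing one from each makes the squares correspond to all triples of weight smaller by two.
corner : Tri → Bool → Bool → Tri
corner (a , d , e) false false = a , suc d , suc e
corner (a , d , e) true  false = suc a , d , suc e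
corner (a , d , e) false true  = a , suc (suc d) , e
corner (a , d , e) true  true  = suc a , suc d , e

-- Four starting corners and two directions: the eight closed walks per cycle by which `fourCycles`
-- divides.
Orientation : Set
Orientation = Bool × Bool × Bool

-- The unit square t, traversed from its corner (x , y), first in the
-- a-direction or first in the b-direction.
traverse : Tri × Orientation → Quad Tri
traverse (t , x , y , true)  = corner t x y , corner t (not x) y , corner t (not x) (not y) , corner t x (not y)
traverse (t , x , y , false) = corner t x y , corner t x (not y) , corner t (not x) (not y) , corner t (not x) y

-- One vertex may belong to four squares, but the diagonal displacement reveals `x` and `y`, and
-- then the vertex reveals `t`.
opposite-corners-injective : ∀ {t t′} x y x′ y′ → corner t x y ≡ corner t′ x′ y′ →
  corner t (not x) (not y) ≡ corner t′ (not x′) (not y′) → (t , x , y) ≡ (t′ , x′ , y′)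
opposite-corners-injective false false false false refl refl = refl
opposite-corners-injective false false false true  refl ()
opposite-corners-injective false false true  false refl ()
opposite-corners-injective false false true  true  refl ()
opposite-corners-injective false true  false false refl ()
opposite-corners-injective false true  false true  refl refl = refl
opposite-corners-injective false true  true  false refl ()
opposite-corners-injective false true  true  true  refl ()
opposite-corners-injective true  false false false refl ()
opposite-corners-injective true  false false true  refl ()
opposite-corners-injective true  false true  false refl refl = refl
opposite-corners-injective true  false true  true  refl ()
opposite-corners-injective true  true  false false refl ()
opposite-corners-injective true  true  false true  refl ()
opposite-corners-injective true  true  true  false refl ()
opposite-corners-injective true  true  true  true  refl refl = refl

adjacent-corners-differ : ∀ t x y → corner t (not x) y ≢ corner t x (not y)
adjacent-corners-differ t false false ()
adjacent-corners-differ t false true  ()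
adjacent-corners-differ t true  false ()
adjacent-corners-differ t true  true  ()

traverse-injective : ∀ u v → traverse u ≡ traverse v → u ≡ v
traverse-injective (_ , x , y , false) (_ , x′ , y′ , false) e
  with refl ← opposite-corners-injective x y x′ y′ (cong proj₁ e) (cong (proj₁ ∘ proj₂ ∘ proj₂) e) = refl
traverse-injective (_ , x , y , true) (_ , x′ , y′ , true) e
  with refl ← opposite-corners-injective x y x′ y′ (cong proj₁ e) (cong (proj₁ ∘ proj₂ ∘ proj₂) e) = refl
traverse-injective (t , x , y , false) (_ , x′ , y′ , true) e
  with refl ← opposite-corners-injective x y x′ y′ (cong proj₁ e) (cong (proj₁ ∘ proj₂ ∘ proj₂) e) =
  ⊥-elim (adjacent-corners-differ t x y (sym (cong (proj₁ ∘ proj₂) e)))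
traverse-injective (t , x , y , true) (_ , x′ , y′ , false) e
  with refl ← opposite-corners-injective x y x′ y′ (cong proj₁ e) (cong (proj₁ ∘ proj₂ ∘ proj₂) e) =
  ⊥-elim (adjacent-corners-differ t x y (cong (proj₁ ∘ proj₂) e))

corner-weight : ∀ t x y → weight (corner t x y) ≡ 2 + weight t
corner-weight (a , d , e) false false = cong suc (+-suc e (d + a))
corner-weight (a , d , e) true  false = cong suc (trans (cong (e +_) (+-suc d a)) (+-suc e (d + a)))
corner-weight (a , d , e) false true  = trans (+-suc e _) (cong suc (+-suc e (d + a)))
corner-weight (a , d , e) true  true  =
  trans (+-suc e _) (cong suc (trans (cong (e +_) (+-suc d a)) (+-suc e (d + a))))

-- Distinct diagonals forbid backtracking. Of the remaining step sequences only the eight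
-- alternating ones have zero displacement; unification rejects the others.
square : ∀ {p q r s} → Step p q → Step q r → Step r s → Step s p → p ≢ r → q ≢ s →
  ∃ λ v → traverse v ≡ (p , q , r , s)
square a⁺ a⁻ _  _  n _ = ⊥-elim (n refl)
square a⁻ a⁺ _  _  n _ = ⊥-elim (n refl)
square b⁺ b⁻ _  _  n _ = ⊥-elim (n refl)
square b⁻ b⁺ _  _  n _ = ⊥-elim (n refl)
square _  a⁺ a⁻ _  _ n = ⊥-elim (n refl)
square _  a⁻ a⁺ _  _ n = ⊥-elim (n refl)
square _  b⁺ b⁻ _  _ n = ⊥-elim (n refl)
square _  b⁻ b⁺ _  _ n = ⊥-elim (n refl)
square a⁺ b⁺ a⁻ b⁻ _ _ = (_ , false , false , true)  , refl
square a⁺ b⁻ a⁻ b⁺ _ _ = (_ , false , true  , true)  , refl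
square a⁻ b⁺ a⁺ b⁻ _ _ = (_ , true  , false , true)  , refl
square a⁻ b⁻ a⁺ b⁺ _ _ = (_ , true  , true  , true)  , refl
square b⁺ a⁺ b⁻ a⁻ _ _ = (_ , false , false , false) , refl
square b⁺ a⁻ b⁻ a⁺ _ _ = (_ , true  , false , false) , refl
square b⁻ a⁺ b⁺ a⁻ _ _ = (_ , false , true  , false) , refl
square b⁻ a⁻ b⁺ a⁺ _ _ = (_ , true  , true  , false) , refl

ClosedWalk : Quad Tri → Set
ClosedWalk (p , q , r , s) =
  (Step p q × Step q r × Step r s × Step s p) ×
  (p ≢ q × p ≢ r × p ≢ s × q ≢ r × q ≢ s × r ≢ s)

traverse-closed : ∀ v → ClosedWalk (traverse v)
traverse-closed (_ , false , false , false) = (b⁺ , a⁺ , b⁻ , a⁻) , (λ ()) , (λ ()) , (λ ()) , (λ ()) , (λ ()) , (λ ())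
traverse-closed (_ , false , false , true)  = (a⁺ , b⁺ , a⁻ , b⁻) , (λ ()) , (λ ()) , (λ ()) , (λ ()) , (λ ()) , (λ ())
traverse-closed (_ , false , true  , false) = (b⁻ , a⁺ , b⁺ , a⁻) , (λ ()) , (λ ()) , (λ ()) , (λ ()) , (λ ()) , (λ ())
traverse-closed (_ , false , true  , true)  = (a⁺ , b⁻ , a⁻ , b⁺) , (λ ()) , (λ ()) , (λ ()) , (λ ()) , (λ ()) , (λ ())
traverse-closed (_ , true  , false , false) = (b⁺ , a⁻ , b⁻ , a⁺) , (λ ()) , (λ ()) , (λ ()) , (λ ()) , (λ ()) , (λ ())
traverse-closed (_ , true  , false , true)  = (a⁻ , b⁺ , a⁺ , b⁻) , (λ ()) , (λ ()) , (λ ()) , (λ ()) , (λ ()) , (λ ())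
traverse-closed (_ , true  , true  , false) = (b⁻ , a⁻ , b⁺ , a⁺) , (λ ()) , (λ ()) , (λ ()) , (λ ()) , (λ ()) , (λ ())
traverse-closed (_ , true  , true  , true)  = (a⁻ , b⁻ , a⁺ , b⁺) , (λ ()) , (λ ()) , (λ ()) , (λ ()) , (λ ()) , (λ ())

-- The graph of reduced words

∈-reducedWords⁻ : ∀ m w {u} → u ∈ reducedWords m w →
  (∀ {x} → 1 ≤ x → x ≤ m → evalWord u x ≡ w x) × length u ≡ inversions m w
∈-reducedWords⁻ m w {u} u∈ =
  (λ l h → ==⇒≡ (All.lookup (All.all⁺ (λ x → evalWord u x == w x) (range 1 m) (proj₁ t)) (∈-range⁺ 1 m l (s≤s h)))) ,
  ==⇒≡ (proj₂ t)
  where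
  t = Equivalence.to (T-∧ {and (map (λ x → evalWord u x == w x) (range 1 m))})
    (proj₂ (Equivalence.to (T-∧ {and (map (λ a → (1 ≤ᵇ a) ∧ (a <ᵇ m)) u)})
      (proj₂ (∈-filter⁻ (T? ∘ isReducedWord m w) {xs = words (inversions m w) (m ∸ 1)} u∈))))

∈-reducedWords⁺ : ∀ m w {u} → All (λ a → 1 ≤ a × a < suc m) u →
  (∀ {x} → 1 ≤ x → x ≤ suc m → evalWord u x ≡ w x) → length u ≡ inversions (suc m) w →
  u ∈ reducedWords (suc m) w
∈-reducedWords⁺ m w {u} letters e l = ∈-filter⁺ (T? ∘ isReducedWord (suc m) w)
  (subst (λ l → u ∈ words l m) l (∈-words⁺ letters))
  (Equivalence.from (T-∧ {and (map (λ a → (1 ≤ᵇ a) ∧ (a <ᵇ suc m)) u)})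
    ( All.all⁻ (λ a → (1 ≤ᵇ a) ∧ (a <ᵇ suc m))
        (All.map (λ {a} (l , h) → Equivalence.from (T-∧ {1 ≤ᵇ a}) (≤⇒≤ᵇ l , <⇒<ᵇ h)) letters)
    , Equivalence.from (T-∧ {and (map (λ x → evalWord u x == w x) (range 1 (suc m)))})
      ( All.all⁻ (λ x → evalWord u x == w x)
          (All.tabulate {xs = range 1 (suc m)} λ x∈ → let l , h = ∈-range⁻ 1 (suc m) x∈ in ≡⇒== (e l (≤-pred h)))
      , ≡⇒== l)))

unique-reducedWords : ∀ m w → Unique (reducedWords m w)
unique-reducedWords m w = Unique.filter⁺ (T? ∘ isReducedWord m w) (unique-words (inversions m w) (m ∸ 1))

-- The inversions and the vertices of `nw (4 + k)`

module _ (k : ℕ) where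

  nw-upper : ∀ {j} → j ≤ 2 + k → nw (4 + k) (2 + j) < 4 + k
  nw-upper l with nw-cases k l
  ... | inj₁ (j<k , e)               = subst (_< 4 + k) (sym e) (s≤s (≤-trans j<k (m≤n+m k 3)))
  ... | inj₂ (inj₁ (_ , e))          = subst (_< 4 + k) (sym e) (n≤1+n _)
  ... | inj₂ (inj₂ (inj₁ (_ , e)))   = subst (_< 4 + k) (sym e) ≤-refl
  ... | inj₂ (inj₂ (inj₂ (_ , e)))   = subst (_< 4 + k) (sym e) (m≤n+m _ 2)

  nw-lower : ∀ {i j} → i < k → i ≤ j → j ≤ 2 + k → 1 + i ≤ nw (4 + k) (2 + j)
  nw-lower {i} i<k i≤j l with nw-cases k l
  ... | inj₁ (_ , e)                 = subst (1 + i ≤_) (sym e) (s≤s i≤j)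
  ... | inj₂ (inj₁ (_ , e))          = subst (1 + i ≤_) (sym e) (≤-trans i<k (m≤n+m k 2))
  ... | inj₂ (inj₂ (inj₁ (_ , e)))   = subst (1 + i ≤_) (sym e) (≤-trans i<k (m≤n+m k 3))
  ... | inj₂ (inj₂ (inj₂ (_ , e)))   = subst (1 + i ≤_) (sym e) (≤-trans i<k (n≤1+n k))

  inversionsAt : ℕ → ℕ
  inversionsAt i = count (λ j → nw (4 + k) j <ᵇ nw (4 + k) i) (range (suc i) (4 + k ∸ i))

  inversionsAt-1 : inversionsAt 1 ≡ 3 + k
  inversionsAt-1 = trans (count-all _ (All.tabulate λ {j} → below-n j ∘ ∈-range⁻ 2 (3 + k))) (length-range 2 (3 + k))
    where
    below-n : ∀ j → 2 ≤ j × j < 5 + k → T (nw (4 + k) j <ᵇ 4 + k)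
    below-n (suc (suc j)) (_ , s≤s (s≤s l)) = <⇒<ᵇ (nw-upper (≤-pred l))
    below-n (suc zero) (s≤s () , _)

  inversionsAt-below : ∀ {i} → i < k → inversionsAt (2 + i) ≡ 0
  inversionsAt-below {i} i<k = count-none _ (All.tabulate λ {j} → not-below j ∘ ∈-range⁻ (3 + i) (2 + k ∸ i))
    where
    bound : ∀ {j} → j < 3 + i + (2 + k ∸ i) → j ≤ 4 + k
    bound {j} p = ≤-pred (subst (j <_) (cong (3 +_) (m+[n∸m]≡n {i} (≤-trans (<⇒≤ i<k) (m≤n+m k 2)))) p)
    not-below : ∀ j → 3 + i ≤ j × j < 3 + i + (2 + k ∸ i) → ¬ T (nw (4 + k) j <ᵇ nw (4 + k) (2 + i))
    not-below (suc (suc j)) (s≤s (s≤s i<j) , p) t = <⇒≱ (<ᵇ⇒< _ _ t)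
      (≤-trans (≤-reflexive (nw-below k i<k)) (nw-lower i<k (<⇒≤ i<j) (≤-pred (≤-pred (bound p)))))
    not-below (suc zero) (s≤s () , _)

  inversionsAt-top : inversionsAt (2 + k) ≡ 1 × inversionsAt (3 + k) ≡ 1 × inversionsAt (4 + k) ≡ 0
  inversionsAt-top = two , three , four
    where
    a = proj₁ (nw-values k)
    b = proj₁ (proj₂ (nw-values k))
    c = proj₂ (proj₂ (nw-values k))
    smaller : ∀ {i j x y} → nw (4 + k) i ≡ x → nw (4 + k) j ≡ y → x < y → T (nw (4 + k) i <ᵇ nw (4 + k) j)
    smaller e f l = <⇒<ᵇ (subst₂ _<_ (sym e) (sym f) l)
    larger : ∀ {i j x y} → nw (4 + k) i ≡ x → nw (4 + k) j ≡ y → y ≤ x → ¬ T (nw (4 + k) i <ᵇ nw (4 + k) j)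
    larger e f l t = <⇒≱ (<ᵇ⇒< _ _ t) (subst₂ _≤_ (sym f) (sym e) l)
    less : ℕ → ℕ → Bool
    less i j = nw (4 + k) j <ᵇ nw (4 + k) i
    two : inversionsAt (2 + k) ≡ 1
    two = trans (cong (count (less (2 + k)) ∘ range (3 + k)) (m+n∸n≡m 2 k))
      (trans (count-reject (less (2 + k)) {3 + k} {4 + k ∷ []} (larger {3 + k} {2 + k} b a (n≤1+n _)))
             (count-accept (less (2 + k)) {4 + k} {[]} (smaller {4 + k} {2 + k} c a ≤-refl)))
    three : inversionsAt (3 + k) ≡ 1
    three = trans (cong (count (less (3 + k)) ∘ range (4 + k)) (m+n∸n≡m 1 k))
      (count-accept (less (3 + k)) {4 + k} {[]} (smaller {4 + k} {3 + k} c b (n≤1+n _)))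
    four : inversionsAt (4 + k) ≡ 0
    four = cong (count (less (4 + k)) ∘ range (5 + k)) (n∸n≡0 k)

  -- The value `n` in front gives `n - 1` inversions, and the final `n - 3` gives one with each of
  -- its two predecessors.
  inversions-nw : inversions (4 + k) (nw (4 + k)) ≡ 5 + k
  inversions-nw = begin
    inversionsAt 1 + sum (map inversionsAt (range 2 (3 + k)))
      ≡⟨ cong₂ _+_ inversionsAt-1 (cong (sum ∘ map inversionsAt) (trans (cong (range 2) (+-comm 3 k)) (range-++ 2 k 3))) ⟩
    3 + k + sum (map inversionsAt (range 2 k ++ range (k + 2) 3))
      ≡⟨ cong (3 + k +_) (trans (cong sum (map-++ inversionsAt (range 2 k) _)) (sum-++ (map inversionsAt (range 2 k)) _)) ⟩
    3 + k + (sum (map inversionsAt (range 2 k)) + sum (map inversionsAt (range (k + 2) 3)))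
      ≡⟨ cong (λ x → 3 + k + (x + sum (map inversionsAt (range (k + 2) 3))))
           (sum-zero (All.map⁺ (All.tabulate λ {i} → below i ∘ ∈-range⁻ 2 k))) ⟩
    3 + k + sum (map inversionsAt (range (k + 2) 3))
      ≡⟨ cong (λ a → 3 + k + sum (map inversionsAt (range a 3))) (+-comm k 2) ⟩
    3 + k + (inversionsAt (2 + k) + (inversionsAt (3 + k) + (inversionsAt (4 + k) + 0)))
      ≡⟨ cong (3 + k +_) (cong₂ _+_ (proj₁ inversionsAt-top)
           (cong₂ _+_ (proj₁ (proj₂ inversionsAt-top)) (cong (_+ 0) (proj₂ (proj₂ inversionsAt-top))))) ⟩
    3 + k + 2
      ≡⟨ +-comm (3 + k) 2 ⟩
    5 + k ∎
    where
    open ≡-Reasoning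
    sum-zero : ∀ {xs} → All (_≡ 0) xs → sum xs ≡ 0
    sum-zero []       = refl
    sum-zero (refl ∷ ps) = sum-zero ps
    below : ∀ i → 2 ≤ i × i < 2 + k → inversionsAt i ≡ 0
    below (suc (suc i)) (_ , s≤s (s≤s i<k)) = inversionsAt-below i<k
    below (suc zero) (s≤s () , _)

  ∈-reducedWords-nw⁻ : ∀ {u} → u ∈ reducedWords (4 + k) (nw (4 + k)) → ∃ λ p → weight p ≡ 2 + k × u ≡ word k p
  ∈-reducedWords-nw⁻ {u} u∈ = let e , l = ∈-reducedWords⁻ (4 + k) (nw (4 + k)) u∈ in
    word-of-path k (path-of-reduced k u e (trans l inversions-nw))

  ∈-reducedWords-nw⁺ : ∀ p → weight p ≡ 2 + k → word k p ∈ reducedWords (4 + k) (nw (4 + k))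
  ∈-reducedWords-nw⁺ p s = ∈-reducedWords⁺ (3 + k) (nw (4 + k)) (letters-path k path ≤-refl) (evalWord-nw k path)
    (trans (length-path k path) (trans (+-comm (3 + k) 2) (sym inversions-nw)))
    where path = path-word k p s

adjacent⇒Move : ∀ u v → T (adjacent u v) → Move u v
adjacent⇒Move u v t = oneMove⇒Move u (toWitness {a? = v ∈? oneMove u} t)

Move⇒adjacent : ∀ u v → Move u v → T (adjacent u v)
Move⇒adjacent u v m = fromWitness {a? = v ∈? oneMove u} (Move⇒oneMove m)

distinct : List ℕ → List ℕ → Bool
distinct u v = not (⌊ ≡-dec _≟_ u v ⌋)

-- Has exactly the form of the test inside `fourCycles`, so that `fourCycles-quads` holds up to
-- conversion.
isFourCycle : Quad (List ℕ) → Bool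
isFourCycle (a , b , c , d) = adjacent a b ∧ adjacent b c ∧ adjacent c d ∧ adjacent d a
  ∧ distinct a b ∧ distinct a c ∧ distinct a d ∧ distinct b c ∧ distinct b d ∧ distinct c d

FourCycle : Quad (List ℕ) → Set
FourCycle (a , b , c , d) =
  (Move a b × Move b c × Move c d × Move d a) ×
  (a ≢ b × a ≢ c × a ≢ d × b ≢ c × b ≢ d × c ≢ d)

isFourCycle⁻ : ∀ q → T (isFourCycle q) → FourCycle q
isFourCycle⁻ (a , b , c , d) t₀
  with p₁ , t₁ ← Equivalence.to (T-∧ {adjacent a b}) t₀
  with p₂ , t₂ ← Equivalence.to (T-∧ {adjacent b c}) t₁
  with p₃ , t₃ ← Equivalence.to (T-∧ {adjacent c d}) t₂
  with p₄ , t₄ ← Equivalence.to (T-∧ {adjacent d a}) t₃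
  with d₁ , t₅ ← Equivalence.to (T-∧ {distinct a b}) t₄
  with d₂ , t₆ ← Equivalence.to (T-∧ {distinct a c}) t₅
  with d₃ , t₇ ← Equivalence.to (T-∧ {distinct a d}) t₆
  with d₄ , t₈ ← Equivalence.to (T-∧ {distinct b c}) t₇
  with d₅ , d₆ ← Equivalence.to (T-∧ {distinct b d}) t₈ =
  (adjacent⇒Move a b p₁ , adjacent⇒Move b c p₂ , adjacent⇒Move c d p₃ , adjacent⇒Move d a p₄) ,
  (≢ a b d₁ , ≢ a c d₂ , ≢ a d d₃ , ≢ b c d₄ , ≢ b d d₅ , ≢ c d d₆)
  where
  ≢ : ∀ u v → T (distinct u v) → u ≢ v
  ≢ u v = toWitnessFalse {a? = ≡-dec _≟_ u v}

isFourCycle⁺ : ∀ q → FourCycle q → T (isFourCycle q)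
isFourCycle⁺ (a , b , c , d) ((p₁ , p₂ , p₃ , p₄) , (d₁ , d₂ , d₃ , d₄ , d₅ , d₆)) =
  Equivalence.from (T-∧ {adjacent a b}) (Move⇒adjacent a b p₁ ,
  Equivalence.from (T-∧ {adjacent b c}) (Move⇒adjacent b c p₂ ,
  Equivalence.from (T-∧ {adjacent c d}) (Move⇒adjacent c d p₃ ,
  Equivalence.from (T-∧ {adjacent d a}) (Move⇒adjacent d a p₄ ,
  Equivalence.from (T-∧ {distinct a b}) (≢ a b d₁ ,
  Equivalence.from (T-∧ {distinct a c}) (≢ a c d₂ ,
  Equivalence.from (T-∧ {distinct a d}) (≢ a d d₃ ,
  Equivalence.from (T-∧ {distinct b c}) (≢ b c d₄ ,
  Equivalence.from (T-∧ {distinct b d}) (≢ b d d₅ , ≢ c d d₆)))))))))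
  where
  ≢ : ∀ u v → u ≢ v → T (distinct u v)
  ≢ u v = fromWitnessFalse {a? = ≡-dec _≟_ u v}

quads : {X : Set} → List X → List (Quad X)
quads xs = cartesianProduct xs (cartesianProduct xs (cartesianProduct xs xs))

length-closedWalks : (U : List (List ℕ)) →
  length (concatMap (λ a → concatMap (λ b → concatMap (λ c →
    filterᵇ (λ d → isFourCycle (a , b , c , d)) U) U) U) U) ≡ count isFourCycle (quads U)
length-closedWalks U =
  length-concatMap-cartesianProduct
     (λ a → concatMap (λ b → concatMap (λ c → filterᵇ (λ d → isFourCycle (a , b , c , d)) U) U) U)
     isFourCycle (cartesianProduct U (cartesianProduct U U)) (λ a →
   length-concatMap-cartesianProduct
     (λ b → concatMap (λ c → filterᵇ (λ d → isFourCycle (a , b , c , d)) U) U)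
     (λ r → isFourCycle (a , r)) (cartesianProduct U U) (λ b →
   length-concatMap-cartesianProduct
     (λ c → filterᵇ (λ d → isFourCycle (a , b , c , d)) U)
     (λ r → isFourCycle (a , b , r)) U (λ c → refl) U) U) U

fourCycles-quads : ∀ m w → fourCycles m w ≡ count isFourCycle (quads (reducedWords m w)) / 8
fourCycles-quads m w = cong (_/ 8) (length-closedWalks (reducedWords m w))

orientations : List Orientation
orientations = cartesianProduct booleans (cartesianProduct booleans booleans)
  where booleans = false ∷ true ∷ []

∈-orientations : ∀ o → o ∈ orientations
∈-orientations (x , y , z) = ∈-cartesianProduct⁺ (bool x) (∈-cartesianProduct⁺ (bool y) (bool z))
  where
  bool : ∀ b → b ∈ false ∷ true ∷ []
  bool false = here refl
  bool true  = there (here refl)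

unique-orientations : Unique orientations
unique-orientations = Unique.cartesianProduct⁺ bools! (Unique.cartesianProduct⁺ bools! bools!)
  where
  bools! : Unique (false ∷ true ∷ [])
  bools! = ((λ ()) ∷ []) ∷ [] ∷ []

traverse-weight : ∀ {k t o} → weight t ≡ k → let p , q , r , s = traverse (t , o) in
  weight p ≡ 2 + k × weight q ≡ 2 + k × weight r ≡ 2 + k × weight s ≡ 2 + k
traverse-weight {k} {t} {o} e = go o
  where
  c : ∀ x y → weight (corner t x y) ≡ 2 + k
  c x y = trans (corner-weight t x y) (cong (2 +_) e)
  go : ∀ o → let p , q , r , s = traverse (t , o) in
    weight p ≡ 2 + k × weight q ≡ 2 + k × weight r ≡ 2 + k × weight s ≡ 2 + k
  go (x , y , true)  = c x y , c (not x) y , c (not x) (not y) , c x (not y)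
  go (x , y , false) = c x y , c x (not y) , c (not x) (not y) , c (not x) y

traverse-weight⁻ : ∀ {k} t o → weight (proj₁ (traverse (t , o))) ≡ 2 + k → weight t ≡ k
traverse-weight⁻ t (x , y , true)  e = suc-injective (suc-injective (trans (sym (corner-weight t x y)) e))
traverse-weight⁻ t (x , y , false) e = suc-injective (suc-injective (trans (sym (corner-weight t x y)) e))

-- Transfer from the grid to a vertex list known by its members

module _ (k : ℕ) {U : List (List ℕ)} (U! : Unique U)
  (∈-U⁻ : ∀ {u} → u ∈ U → ∃ λ p → weight p ≡ 2 + k × u ≡ word k p)
  (∈-U⁺ : ∀ p → weight p ≡ 2 + k → word k p ∈ U) where

  words-↭ : U ↭ map (word k) (triples (2 + k))
  words-↭ = unique-sets-↭ U!
    (unique-map (word k) (λ p∈ q∈ → word-injective k _ _ (∈-triples⁻ _ p∈) (∈-triples⁻ _ q∈)) (unique-triples (2 + k)))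
    to from
    where
    to : ∀ {u} → u ∈ U → u ∈ map (word k) (triples (2 + k))
    to u∈ with p , s , refl ← ∈-U⁻ u∈ = ∈-map⁺ (word k) (subst (λ m → p ∈ triples m) s (∈-triples⁺ p))
    from : ∀ {u} → u ∈ map (word k) (triples (2 + k)) → u ∈ U
    from u∈ with p , p∈ , refl ← ∈-map⁻ (word k) u∈ = ∈-U⁺ _ (∈-triples⁻ _ p∈)

  -- `move⇒step` supplies some grid neighbour with the same word; injectivity identifies it with
  -- `q`.
  word-move⁻ : ∀ p q → weight p ≡ 2 + k → weight q ≡ 2 + k → Move (word k p) (word k q) → Step p q
  word-move⁻ p q s s′ m with r , st , e ← move⇒step k p s m
    with refl ← word-injective k q r s′ (trans (sym (step-weight st)) s) e = st

  degree-word : ∀ {p} → weight p ≡ 2 + k → count (adjacent (word k p)) U ≡ gridDegree p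
  degree-word {p} s = trans
    (↭-length (unique-sets-↭ (Unique.filter⁺ (T? ∘ adjacent (word k p)) U!)
                             (unique-map (word k) inj (unique-neighbours p)) to from))
    (trans (length-map (word k) (neighbours p)) (length-neighbours p))
    where
    near : ∀ {q} → q ∈ neighbours p → weight q ≡ 2 + k
    near q∈ = trans (sym (step-weight (∈-neighbours⁻ p q∈))) s
    inj : ∀ {q r} → q ∈ neighbours p → r ∈ neighbours p → word k q ≡ word k r → q ≡ r
    inj q∈ r∈ = word-injective k _ _ (near q∈) (near r∈)
    to : ∀ {u} → u ∈ filterᵇ (adjacent (word k p)) U → u ∈ map (word k) (neighbours p)
    to u∈ with u∈V , t ← ∈-filter⁻ (T? ∘ adjacent (word k p)) {xs = U} u∈
      with q , s′ , refl ← ∈-U⁻ u∈V =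
      ∈-map⁺ (word k) (∈-neighbours⁺ (word-move⁻ p q s s′ (adjacent⇒Move _ _ t)))
    from : ∀ {u} → u ∈ map (word k) (neighbours p) → u ∈ filterᵇ (adjacent (word k p)) U
    from u∈ with q , q∈ , refl ← ∈-map⁻ (word k) u∈ =
      ∈-filter⁺ (T? ∘ adjacent (word k p)) (∈-U⁺ _ (near q∈))
        (Move⇒adjacent _ _ (step⇒move k (∈-neighbours⁻ p q∈) s))

  degrees-↭ : map (λ v → count (adjacent v) U) U ↭ columnDegrees 0 (suc k) ++ interiorDegrees (suc k)
  degrees-↭ = subst (map (λ v → count (adjacent v) U) U ↭_)
    (trans (sym (map-∘ (triples (2 + k))))
      (trans (map-cong-local (All.tabulate (λ {p} p∈ → degree-word {p} (∈-triples⁻ _ p∈)))) (map-gridDegree (suc k))))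
    (↭-map (λ v → count (adjacent v) U) words-↭)

  squareWords : Tri × Orientation → Quad (List ℕ)
  squareWords v = mapQuad (word k) (traverse v)

  squares : List (Tri × Orientation)
  squares = cartesianProduct (triples k) orientations

  fourCycles-↭ : filterᵇ isFourCycle (quads U) ↭ map squareWords squares
  fourCycles-↭ = unique-sets-↭
    (Unique.filter⁺ (T? ∘ isFourCycle)
      (Unique.cartesianProduct⁺ U! (Unique.cartesianProduct⁺ U! (Unique.cartesianProduct⁺ U! U!))))
    (unique-map squareWords inj (Unique.cartesianProduct⁺ (unique-triples k) unique-orientations))
    to from
    where
    inj : ∀ {u v} → u ∈ squares → v ∈ squares → squareWords u ≡ squareWords v → u ≡ v
    inj {t , o} {t′ , o′} u∈ v∈ e
      with a , b , c , d ← traverse-weight {k} {t} {o} (∈-triples⁻ k (proj₁ (∈-cartesianProduct⁻ (triples k) orientations u∈)))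
         | a′ , b′ , c′ , d′ ← traverse-weight {k} {t′} {o′} (∈-triples⁻ k (proj₁ (∈-cartesianProduct⁻ (triples k) orientations v∈)))
      = traverse-injective (t , o) (t′ , o′) (cong₂ _,_ (word-injective k _ _ a a′ (cong proj₁ e))
          (cong₂ _,_ (word-injective k _ _ b b′ (cong (proj₁ ∘ proj₂) e))
            (cong₂ _,_ (word-injective k _ _ c c′ (cong (proj₁ ∘ proj₂ ∘ proj₂) e))
                       (word-injective k _ _ d d′ (cong (proj₂ ∘ proj₂ ∘ proj₂) e)))))
    to : ∀ {x} → x ∈ filterᵇ isFourCycle (quads U) → x ∈ map squareWords squares
    to {x} x∈ with x∈′ , t ← ∈-filter⁻ (T? ∘ isFourCycle) {xs = quads U} x∈
      with a∈ , y∈ ← ∈-cartesianProduct⁻ U _ x∈′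
      with b∈ , z∈ ← ∈-cartesianProduct⁻ U _ y∈
      with c∈ , d∈ ← ∈-cartesianProduct⁻ U U z∈
      with p , sp , refl ← ∈-U⁻ a∈ | q , sq , refl ← ∈-U⁻ b∈
         | r , sr , refl ← ∈-U⁻ c∈ | s , ss , refl ← ∈-U⁻ d∈
      with (m₁ , m₂ , m₃ , m₄) , (_ , p≢r , _ , _ , q≢s , _) ← isFourCycle⁻ x t
      with (t , o) , e ← square (word-move⁻ p q sp sq m₁) (word-move⁻ q r sq sr m₂)
                                (word-move⁻ r s sr ss m₃) (word-move⁻ s p ss sp m₄)
                                (p≢r ∘ cong (word k)) (q≢s ∘ cong (word k)) =
      subst (λ v → mapQuad (word k) v ∈ map squareWords squares) e
        (∈-map⁺ squareWords (∈-cartesianProduct⁺ (subst (λ m → t ∈ triples m) w (∈-triples⁺ t)) (∈-orientations o)))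
      where
      w : weight t ≡ k
      w = traverse-weight⁻ t o (subst (λ v → weight (proj₁ v) ≡ 2 + k) (sym e) sp)
    from : ∀ {x} → x ∈ map squareWords squares → x ∈ filterᵇ isFourCycle (quads U)
    from x∈ with (t , o) , v∈ , refl ← ∈-map⁻ squareWords x∈
      with a , b , c , d ← traverse-weight {k} {t} {o} (∈-triples⁻ k (proj₁ (∈-cartesianProduct⁻ (triples k) orientations v∈)))
      with (s₁ , s₂ , s₃ , s₄) , (n₁ , n₂ , n₃ , n₄ , n₅ , n₆) ← traverse-closed (t , o) =
      ∈-filter⁺ (T? ∘ isFourCycle)
        (∈-cartesianProduct⁺ (∈-U⁺ _ a) (∈-cartesianProduct⁺ (∈-U⁺ _ b) (∈-cartesianProduct⁺ (∈-U⁺ _ c) (∈-U⁺ _ d))))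
        (isFourCycle⁺ (squareWords (t , o))
          ( (step⇒move k s₁ a , step⇒move k s₂ b , step⇒move k s₃ c , step⇒move k s₄ d)
          , n₁ ∘ word-injective k _ _ a b , n₂ ∘ word-injective k _ _ a c , n₃ ∘ word-injective k _ _ a d
          , n₄ ∘ word-injective k _ _ b c , n₅ ∘ word-injective k _ _ b d , n₆ ∘ word-injective k _ _ c d))

  count-fourCycles : count isFourCycle (quads U) / 8 ≡ (2 + k) C 2
  count-fourCycles = begin
    count isFourCycle (quads U) / 8       ≡⟨ cong (_/ 8) (↭-length fourCycles-↭) ⟩
    length (map squareWords squares) / 8  ≡⟨ cong (_/ 8) (length-map squareWords squares) ⟩
    length squares / 8                    ≡⟨ cong (_/ 8) (length-cartesianProduct (triples k) orientations) ⟩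
    -- The factor 8 is the number of `orientations`.
    length (triples k) * 8 / 8            ≡⟨ m*n/n≡m (length (triples k)) 8 ⟩
    length (triples k)                    ≡⟨ length-triples k ⟩
    (2 + k) C 2                           ∎
    where open ≡-Reasoning

grid-graph-invariants : ∀ k m w →
  (∀ {u} → u ∈ reducedWords m w → ∃ λ p → weight p ≡ 2 + k × u ≡ word k p) →
  (∀ p → weight p ≡ 2 + k → word k p ∈ reducedWords m w) →
  ((v : ℕ) → vertexDegreeCoeff m w v ≡ rhsCoeff (4 + k) v)
  × (degreeSum m w ≡ 4 * ((3 + k) C 2))
  × (fourCycles m w ≡ (2 + k) C 2)
grid-graph-invariants k m w f g =
  (λ v → trans (sym (count-map (_== v) (degree m w) (reducedWords m w)))
           (trans (count-↭ (_== v) degrees) (count-degrees k v))) ,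
  trans (sum-↭ degrees) (sum-degrees (suc k)) ,
  trans (fourCycles-quads m w) (count-fourCycles k U! f g)
  where
  U! = unique-reducedWords m w
  degrees : map (degree m w) (reducedWords m w) ↭ columnDegrees 0 (suc k) ++ interiorDegrees (suc k)
  degrees = degrees-↭ k U! f g

theorem3p11 : (n : ℕ) → 4 ≤ n →
    ((k : ℕ) → vertexDegreeCoeff n (nw n) k ≡ rhsCoeff n k)
    × (degreeSum n (nw n) ≡ 4 * ((n ∸ 1) C 2))
    × (fourCycles n (nw n) ≡ (n ∸ 2) C 2)
theorem3p11 (suc (suc (suc (suc k)))) (s≤s (s≤s (s≤s (s≤s z≤n)))) =
  grid-graph-invariants k (4 + k) (nw (4 + k)) (∈-reducedWords-nw⁻ k) (∈-reducedWords-nw⁺ k)
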